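{- Let $G$ be a 2-connected non-bipartite graph. The following are equivalent: (i) $G$ is odd-$C_3^+$-free; (ii) $G$ has a totally odd circuit basis; (iii) every odd cycle basis of $G$ is totally odd.
   Context: Graphs are finite, may have parallel edges but no loops; $G$ contains $H$ if $H$ is a subgraph of $G$. A circuit is a connected 2-regular graph (identified with its edge set when convenient); a path is a circuit minus an edge. A totally odd subdivision of a graph $H$ is obtained by replacing each edge $e$ of $H$ by a path with an odd number of edges joining the ends of $e$, paths for distinct edges sharing no inner vertices. $C_3^+$ is the triangle $K_3$ with one edge doubled by a parallel edge. An odd-$C_3^+$ is a totally odd subdivision of $C_3^+$, and $G$ is odd-$C_3^+$-free if it contains no odd-$C_3^+$. A cycle of $G$ is an edge-disjoint union of circuits (a subgraph with all degrees even); the cycle space $\mathcal{C}(G)\subseteq\mathbb{F}_2^{E(G)}$ is spanned by incidence vectors of cycles. A cycle basis is a set of cycles whose incidence vectors form a basis of $\mathcal{C}(G)$ over $\mathbb{F}_2$; a circuit basis is a cycle basis consisting of circuits. A cycle is odd if it has an odd number of edges; a cycle basis is odd if all its elements are odd, and an odd cycle basis is totally odd if any two of its elements share an odd number of edges. -}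

module Defs where

open import Data.Nat using (ℕ; zero; suc; _+_; _%_; _≥_)
open import Data.Bool using (Bool; true; false; if_then_else_; _∧_; _xor_)
open import Data.Fin using (Fin; zero; suc; toℕ; fromℕ; inject₁; _≟_)
open import Data.Product using (Σ; _×_; _,_; ∃; ∃-syntax)
open import Data.Sum using (_⊎_)
open import Relation.Nullary using (¬_; does)
open import Relation.Binary.PropositionalEquality using (_≡_; _≢_)
open import Relation.Binary.Construct.Closure.ReflexiveTransitive using (Star)
open import Function using (_∘_)
open import Function.Definitions using (Injective)

record Graph : Set where
  field
    n      : ℕ
    m      : ℕ
    src    : Fin m → Fin n
    tgt    : Fin m → Fin n
    noLoop : ∀ e → src e ≢ tgt e

open Graph public

Vertex : Graph → Set
Vertex G = Fin (n G)

Edge : Graph → Set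
Edge G = Fin (m G)

-- edge sets (= incidence vectors in 𝔽₂^{E(G)}, with Bool as 𝔽₂)
EdgeSet : Graph → Set
EdgeSet G = Edge G → Bool

count : ∀ {k} → (Fin k → Bool) → ℕ
count {zero}  f = 0
count {suc k} f = (if f zero then 1 else 0) + count (f ∘ suc)

Odd : ℕ → Set
Odd k = k % 2 ≡ 1

Even : ℕ → Set
Even k = k % 2 ≡ 0

incident : (G : Graph) → Edge G → Vertex G → Bool
incident G e v = does (src G e ≟ v) Data.Bool.∨ does (tgt G e ≟ v)
  where import Data.Bool

deg : (G : Graph) → EdgeSet G → Vertex G → ℕ
deg G S v = count (λ e → S e ∧ incident G e v)

Joins : (G : Graph) → Edge G → Vertex G → Vertex G → Set
Joins G e x y = (src G e ≡ x × tgt G e ≡ y) ⊎ (src G e ≡ y × tgt G e ≡ x)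

IsCycle : (G : Graph) → EdgeSet G → Set
IsCycle G S = ∀ v → Even (deg G S v)

AdjIn : (G : Graph) → EdgeSet G → Edge G → Edge G → Set
AdjIn G S e f = S e ≡ true × S f ≡ true × Σ (Vertex G) (λ v → incident G e v ≡ true × incident G f v ≡ true)

-- a circuit: a nonempty connected 2-regular subgraph (given by its edge set;
-- its vertices are the ends of its edges)
IsCircuit : (G : Graph) → EdgeSet G → Set
IsCircuit G S =
  Σ (Edge G) (λ e → S e ≡ true)
  × (∀ v → deg G S v ≡ 0 ⊎ deg G S v ≡ 2)
  × (∀ e f → S e ≡ true → S f ≡ true → Star (AdjIn G S) e f)

OddSet : (G : Graph) → EdgeSet G → Set
OddSet G S = Odd (count S)

shared : (G : Graph) → EdgeSet G → EdgeSet G → ℕ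
shared G S T = count (λ e → S e ∧ T e)

lincomb : (G : Graph) {k : ℕ} → (Fin k → EdgeSet G) → (Fin k → Bool) → EdgeSet G
lincomb G {zero}  B λ' e = false
lincomb G {suc k} B λ' e = (λ' zero ∧ B zero e) xor lincomb G (B ∘ suc) (λ' ∘ suc) e

LinIndep : (G : Graph) {k : ℕ} → (Fin k → EdgeSet G) → Set
LinIndep G {k} B = ∀ (λ' : Fin k → Bool) → (∀ e → lincomb G B λ' e ≡ false) → ∀ i → λ' i ≡ false

-- the cycle space C(G) is spanned by (incidence vectors of) cycles; since
-- cycles are closed under symmetric difference, C(G) = { S | IsCycle G S }
Spans : (G : Graph) {k : ℕ} → (Fin k → EdgeSet G) → Set
Spans G {k} B = ∀ S → IsCycle G S → Σ (Fin k → Bool) (λ λ' → ∀ e → lincomb G B λ' e ≡ S e)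

IsCycleBasis : (G : Graph) {k : ℕ} → (Fin k → EdgeSet G) → Set
IsCycleBasis G B = (∀ i → IsCycle G (B i)) × LinIndep G B × Spans G B

IsCircuitBasis : (G : Graph) {k : ℕ} → (Fin k → EdgeSet G) → Set
IsCircuitBasis G B = IsCycleBasis G B × (∀ i → IsCircuit G (B i))

IsOddFamily : (G : Graph) {k : ℕ} → (Fin k → EdgeSet G) → Set
IsOddFamily G B = ∀ i → OddSet G (B i)

IsTotallyOddFamily : (G : Graph) {k : ℕ} → (Fin k → EdgeSet G) → Set
IsTotallyOddFamily G B = IsOddFamily G B × (∀ i j → i ≢ j → Odd (shared G (B i) (B j)))

HasTotallyOddCircuitBasis : Graph → Set
HasTotallyOddCircuitBasis G =
  Σ ℕ (λ k → Σ (Fin k → EdgeSet G) (λ B → IsCircuitBasis G B × IsTotallyOddFamily G B))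

EveryOddCycleBasisTotallyOdd : Graph → Set
EveryOddCycleBasisTotallyOdd G =
  ∀ (k : ℕ) (B : Fin k → EdgeSet G) → IsCycleBasis G B → IsOddFamily G B → IsTotallyOddFamily G B

record GPath (G : Graph) : Set where
  field
    len      : ℕ
    vert     : Fin (suc len) → Vertex G
    edge     : Fin len → Edge G
    vertInj  : Injective _≡_ _≡_ vert
    edgeInj  : Injective _≡_ _≡_ edge
    joins    : ∀ i → Joins G (edge i) (vert (inject₁ i)) (vert (suc i))

open GPath public

start : ∀ {G} → GPath G → Vertex G
start P = vert P zero

end : ∀ {G} → GPath G → Vertex G
end P = vert P (fromℕ (len P))

Inner : ∀ {G} → GPath G → Vertex G → Set
Inner P v = Σ (Fin (suc (len P))) (λ i → vert P i ≡ v × toℕ i ≢ 0 × toℕ i ≢ len P)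

UsesEdge : ∀ {G} → GPath G → Edge G → Set
UsesEdge P e = Σ (Fin (len P)) (λ i → edge P i ≡ e)

-- Odd-C₃⁺: C₃⁺ has vertices a,b,c and edges ab, ab', bc, ca.
-- A totally odd subdivision inside G: distinct branch vertices a b c and
-- four odd paths P₀,P₁ : a–b, P₂ : b–c, P₃ : c–a, pairwise without common
-- inner vertices or common edges, inner vertices avoiding a, b, c.

branchEnds : {A : Set} → A → A → A → Fin 4 → A × A
branchEnds a b c zero                   = a , b
branchEnds a b c (suc zero)             = a , b
branchEnds a b c (suc (suc zero))       = b , c
branchEnds a b c (suc (suc (suc zero))) = c , a

record OddC3+ (G : Graph) : Set where
  field
    a b c   : Vertex G
    ab      : a ≢ b
    bc      : b ≢ c
    ca      : c ≢ a
    path    : Fin 4 → GPath G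
    ends    : ∀ i → (start (path i) , end (path i)) ≡ branchEnds a b c i
    oddLen  : ∀ i → Odd (len (path i))
    innerAvoid : ∀ i v → Inner (path i) v → v ≢ a × v ≢ b × v ≢ c
    innerDisj  : ∀ i j → i ≢ j → ∀ v → Inner (path i) v → ¬ Inner (path j) v
    edgeDisj   : ∀ i j → i ≢ j → ∀ e → UsesEdge (path i) e → ¬ UsesEdge (path j) e

OddC3+Free : Graph → Set
OddC3+Free G = ¬ OddC3+ G

data ReachAvoid (G : Graph) (x : Vertex G) : Vertex G → Vertex G → Set where
  here : ∀ {u} → ReachAvoid G x u u
  step : ∀ {u w v} (e : Edge G) → Joins G e u w → w ≢ x → ReachAvoid G x w v → ReachAvoid G x u v

-- 2-connected: at least 3 vertices, and G - x is connected for every vertex x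
-- (in particular G itself is connected, as n ≥ 3)
TwoConnected : Graph → Set
TwoConnected G = n G ≥ 3 × (∀ x u v → u ≢ x → v ≢ x → ReachAvoid G x u v)

Bipartite : Graph → Set
Bipartite G = Σ (Vertex G → Bool) (λ col → ∀ e → col (src G e) ≢ col (tgt G e))

NonBipartite : Graph → Set
NonBipartite G = ¬ Bipartite G

{-# OPTIONS --safe #-}

-- Write ⟨S,D⟩ for |S ∩ D| mod 2.  A totally odd basis forces ⟨S,D⟩ = |S||D| mod 2 for all cycles S, D,
-- whence (ii) ⇒ (iii); an odd-C₃⁺ is a theta with paths of parity odd, odd, even, whose two odd circuits
-- violate this identity, whence (ii) ⇒ (i).
--
-- For the converses, let W be a set of at least two vertices of a 2-connected graph, coloured by F : W → 𝔽₂,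
-- and T a set of edges with ends in W.  Either some path between distinct u, v ∈ W with interior outside W and
-- edges outside T (an ear) has parity ≠ F u + F v, or F extends to all vertices so that every edge outside T is
-- bichromatic: add an ear to W, colour it, and repeat; an ear of the larger set whose parity is wrong becomes
-- one of W by prolonging its ends along the added ear.  Take for W and T the vertices and edges of a circuit C.
--
-- * If C is odd and F = 0, an ear of wrong parity is odd and gives an odd-C₃⁺; otherwise the edges
--   off C form a cut, so ⟨C,D⟩ = |D| mod 2 for every cycle D, which yields (ii) from (i) once odd circuits span.
-- * If C is even and F colours it properly, an ear of wrong parity writes C as the sum of two odd
--   circuits; otherwise G would be bipartite.  Hence the odd circuits span the cycle space.
module Submission where

open import Defs
open import Algebra.Bundles using (CommutativeMonoid; CommutativeRing)
open import Data.Bool using (Bool; true; false; not; if_then_else_; _∧_; _∨_; _xor_)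
open import Data.Bool.Properties using (xor-∧-commutativeRing; xor-same; xor-comm; xor-assoc; xor-identityʳ; ∧-comm; ∧-identityʳ; ∧-idem; ∧-assoc; ∧-zeroʳ; ∨-zeroʳ; ∧-distribʳ-xor; ∧-distribˡ-xor; ¬-not; not-involutive; not-distribˡ-xor) renaming (_≟_ to _≟ᵇ_)
open import Algebra.Properties.CommutativeSemigroup (CommutativeMonoid.commutativeSemigroup (CommutativeRing.+-commutativeMonoid xor-∧-commutativeRing)) using () renaming (interchange to xor-interchange; x∙yz≈y∙xz to xor-left-comm)
open import Data.Empty using (⊥; ⊥-elim)
open import Data.Fin using (Fin; zero; suc; toℕ; fromℕ; inject₁; _≟_)
open import Data.Fin.Properties using (all?; any?; toℕ-fromℕ)
open import Data.List using (List; []; _∷_; _++_)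
import Data.List.Membership.DecPropositional as DecMembership
open import Data.List.Membership.Propositional using (_∈_; _∉_)
open import Data.List.Membership.Propositional.Properties using (∈-++⁺ˡ; ∈-++⁺ʳ; ∈-++⁻)
open import Data.List.Relation.Binary.Disjoint.Propositional using (Disjoint)
open import Data.List.Relation.Binary.Permutation.Propositional using (_↭_; prep; ↭-refl; ↭-sym; ↭-trans; ↭⇒↭ₛ)
open import Data.List.Relation.Binary.Permutation.Propositional.Properties using (∈-resp-↭; ++-comm; ∷↭∷ʳ)
import Data.List.Relation.Binary.Permutation.Setoid.Properties as Permutation
open import Data.List.Relation.Unary.All using ([]; _∷_)
open import Data.List.Relation.Unary.All.Properties using (¬Any⇒All¬)
open import Data.List.Relation.Unary.AllPairs using ([]; _∷_)
open import Data.List.Relation.Unary.Any using (here; there)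
open import Data.List.Relation.Unary.Unique.Propositional using (Unique)
open import Data.List.Relation.Unary.Unique.Propositional.Properties using (Unique[x∷xs]⇒x∉xs) renaming (++⁺ to unique-++⁺)
open import Data.Nat using (ℕ; zero; suc; _+_; _%_; _≤_; _<_; z≤n; s≤s; s≤s⁻¹)
open import Data.Nat.Properties using (+-mono-≤; +-monoʳ-≤; +-suc; +-identityʳ; ≤-refl; ≤-trans; <-≤-trans; m≤n+m; m≤n⇒m≤1+n)
open import Data.Product using (Σ; Σ-syntax; ∃₂; ∃-syntax; _×_; _,_; proj₁; proj₂)
open import Data.Sum using (_⊎_; inj₁; inj₂)
open import Data.Vec.Functional using () renaming (_∷_ to _∷ᵛ_)
open import Function using (_∘_; id)
open import Function.Bundles using (_⇔_; mk⇔)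
open import Relation.Binary.Construct.Closure.ReflexiveTransitive using (Star; ε; _◅_; _◅◅_) renaming (reverse to star-reverse)
open import Relation.Binary.Definitions using (Symmetric)
open import Relation.Binary.PropositionalEquality using (_≡_; _≢_; refl; sym; trans; cong; cong₂; subst; subst₂; setoid; module ≡-Reasoning)
open import Relation.Nullary using (¬_; Dec; yes; no; does)
open import Relation.Nullary.Decidable using (dec-true; dec-false; decidable-stable; map′; ¬?; _×-dec_)


-- Sums over 𝔽₂ and counting

private variable
  k l : ℕ
  A : Set

⨁ : (Fin k → Bool) → Bool
⨁ {zero}  f = false
⨁ {suc k} f = f zero xor ⨁ (f ∘ suc)

⨁-cong : {f g : Fin k → Bool} → (∀ i → f i ≡ g i) → ⨁ f ≡ ⨁ g
⨁-cong {zero}  f≗g = refl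
⨁-cong {suc k} f≗g = cong₂ _xor_ (f≗g zero) (⨁-cong (f≗g ∘ suc))

⨁-false : ∀ k → ⨁ {k} (λ _ → false) ≡ false
⨁-false zero    = refl
⨁-false (suc k) = ⨁-false k

⨁-xor : (f g : Fin k → Bool) → ⨁ (λ i → f i xor g i) ≡ ⨁ f xor ⨁ g
⨁-xor {zero}  f g = refl
⨁-xor {suc k} f g =
  trans (cong ((f zero xor g zero) xor_) (⨁-xor (f ∘ suc) (g ∘ suc)))
        (xor-interchange (f zero) (g zero) (⨁ (f ∘ suc)) (⨁ (g ∘ suc)))

⨁-∧ : (b : Bool) (f : Fin k → Bool) → ⨁ (λ i → b ∧ f i) ≡ b ∧ ⨁ f
⨁-∧     true  f = refl
⨁-∧ {k} false f = ⨁-false k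

⨁-swap : (f : Fin k → Fin l → Bool) → ⨁ (λ i → ⨁ (f i)) ≡ ⨁ (λ j → ⨁ (λ i → f i j))
⨁-swap {zero} {l} f = sym (⨁-false l)
⨁-swap {suc k} f =
  trans (cong (⨁ (f zero) xor_) (⨁-swap (f ∘ suc))) (sym (⨁-xor (f zero) (λ j → ⨁ (λ i → f (suc i) j))))

⨁-δ : (j : Fin k) (f : Fin k → Bool) → ⨁ (λ i → does (j ≟ i) ∧ f i) ≡ f j
⨁-δ {suc k} zero    f = trans (cong (f zero xor_) (⨁-false k)) (xor-identityʳ (f zero))
⨁-δ         (suc j) f = ⨁-δ j (f ∘ suc)

⨁-true : (f : Fin k → Bool) → ⨁ f ≡ true → ∃[ i ] f i ≡ true
⨁-true {suc k} f ⨁≡true with f zero in eq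
... | true  = zero , eq
... | false with ⨁-true (f ∘ suc) ⨁≡true
...   | i , fi = suc i , fi

%2-suc : ∀ c b → c % 2 ≡ (if b then 1 else 0) → suc c % 2 ≡ (if not b then 1 else 0)
%2-suc zero          false eq = refl
%2-suc (suc zero)    true  eq = refl
%2-suc (suc (suc c)) b     eq = %2-suc c b eq

count-%2 : (f : Fin k → Bool) → count f % 2 ≡ (if ⨁ f then 1 else 0)
count-%2 {zero}  f = refl
count-%2 {suc k} f with f zero
... | false = count-%2 (f ∘ suc)
... | true  = %2-suc (count (f ∘ suc)) (⨁ (f ∘ suc)) (count-%2 (f ∘ suc))

module _ {k} (f : Fin k → Bool) where

  odd⇒⨁ : Odd (count f) → ⨁ f ≡ true
  odd⇒⨁ odd with ⨁ f | count-%2 f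
  ... | true  | _  = refl
  ... | false | eq with () ← trans (sym eq) odd

  ⨁⇒odd : ⨁ f ≡ true → Odd (count f)
  ⨁⇒odd eq = trans (count-%2 f) (cong (if_then 1 else 0) eq)

  even⇒⨁ : Even (count f) → ⨁ f ≡ false
  even⇒⨁ even with ⨁ f | count-%2 f
  ... | false | _  = refl
  ... | true  | eq with () ← trans (sym eq) even

  ⨁⇒even : ⨁ f ≡ false → Even (count f)
  ⨁⇒even eq = trans (count-%2 f) (cong (if_then 1 else 0) eq)

-- Subadditivity of cardinality. With two singletons on the right it bounds a degree by 2; with an
-- empty second set it becomes monotonicity.
count-cover : {f g h : Fin k → Bool} → (∀ i → f i ≡ true → g i ≡ true ⊎ h i ≡ true) →
  count f ≤ count g + count h
count-cover {zero} cover = z≤n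
count-cover {suc k} {f} {g} {h} cover = bound (f zero) (g zero) (h zero) (cover zero) (count-cover (cover ∘ suc))
  where
  bound : ∀ a b c {x y z} → (a ≡ true → b ≡ true ⊎ c ≡ true) → x ≤ y + z →
    (if a then 1 else 0) + x ≤ ((if b then 1 else 0) + y) + ((if c then 1 else 0) + z)
  bound false b     c {y = y} {z} p le =
    ≤-trans le (+-mono-≤ (m≤n+m y (if b then 1 else 0)) (m≤n+m z (if c then 1 else 0)))
  bound true  true  c {y = y} {z} p le = s≤s (≤-trans le (+-monoʳ-≤ y (m≤n+m z (if c then 1 else 0))))
  bound true  false true {y = y} {z} p le rewrite +-suc y z = s≤s le
  bound true  false false p le with p refl
  ... | inj₁ ()
  ... | inj₂ ()

count-cong : {f g : Fin k → Bool} → (∀ i → f i ≡ g i) → count f ≡ count g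
count-cong {zero}  f≗g = refl
count-cong {suc k} f≗g = cong₂ (λ b c → (if b then 1 else 0) + c) (f≗g zero) (count-cong (f≗g ∘ suc))

count-false : ∀ k → count {k} (λ _ → false) ≡ 0
count-false zero    = refl
count-false (suc k) = count-false k

count-δ : (j : Fin k) → count (λ i → does (j ≟ i)) ≡ 1
count-δ {suc k} zero    = cong suc (count-false k)
count-δ         (suc j) = count-δ j

-- Supplies the decreasing measure when ears are added: the number of vertices not yet reached
-- drops.
count-mono-< : {f g : Fin k → Bool} → (∀ i → f i ≡ true → g i ≡ true) →
  ∀ j → f j ≡ false → g j ≡ true → count f < count g
count-mono-< {suc k} {f} {g} f⊆g zero    fj gj rewrite fj | gj = s≤s (subst (count (f ∘ suc) ≤_) eq (count-cover (λ i → inj₁ ∘ f⊆g (suc i))))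
  where
  eq : count (g ∘ suc) + count {k} (λ _ → false) ≡ count (g ∘ suc)
  eq rewrite count-false k = +-identityʳ _
count-mono-< {suc k} {f} {g} f⊆g (suc j) fj gj with f zero | g zero | f⊆g zero
... | false | false | _ = count-mono-< (f⊆g ∘ suc) j fj gj
... | false | true  | _ = m≤n⇒m≤1+n (count-mono-< (f⊆g ∘ suc) j fj gj)
... | true  | true  | _ = s≤s (count-mono-< (f⊆g ∘ suc) j fj gj)
... | true  | false | p with () ← p refl

true≢false : true ≢ false
true≢false ()

xor-≡false : ∀ a b → a xor b ≡ false → a ≡ b
xor-≡false false b    eq = sym eq
xor-≡false true  true eq = refl

xor-fixed : ∀ a b → a xor b ≡ a → b ≡ false
xor-fixed false b     eq = eq
xor-fixed true  false eq = refl

∧-true : ∀ a b → a ∧ b ≡ true → a ≡ true × b ≡ true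
∧-true true true eq = refl , refl

xor-cancelˡ : ∀ a b → a xor (a xor b) ≡ b
xor-cancelˡ false b = refl
xor-cancelˡ true  b = not-involutive b

-- The pairing on edge sets and linear algebra over 𝔽₂

module LinearAlgebra (G : Graph) where

  ⟨_,_⟩ : EdgeSet G → EdgeSet G → Bool
  ⟨ S , D ⟩ = ⨁ (λ e → S e ∧ D e)

  ⟨⟩-cong : ∀ {S S′ D D′} → (∀ e → S e ≡ S′ e) → (∀ e → D e ≡ D′ e) → ⟨ S , D ⟩ ≡ ⟨ S′ , D′ ⟩
  ⟨⟩-cong S≗ D≗ = ⨁-cong (λ e → cong₂ _∧_ (S≗ e) (D≗ e))

  ⟨⟩-comm : ∀ S D → ⟨ S , D ⟩ ≡ ⟨ D , S ⟩
  ⟨⟩-comm S D = ⨁-cong (λ e → ∧-comm (S e) (D e))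

  ⟨⟩-self : ∀ S → ⟨ S , S ⟩ ≡ ⨁ S
  ⟨⟩-self S = ⨁-cong (λ e → ∧-idem (S e))

  ⟨⟩-xor : ∀ S S′ D → ⟨ (λ e → S e xor S′ e) , D ⟩ ≡ ⟨ S , D ⟩ xor ⟨ S′ , D ⟩
  ⟨⟩-xor S S′ D =
    trans (⨁-cong (λ e → ∧-distribʳ-xor (D e) (S e) (S′ e))) (⨁-xor (λ e → S e ∧ D e) (λ e → S′ e ∧ D e))

  ⟨lincomb,⟩ : (B : Fin k → EdgeSet G) (c : Fin k → Bool) (D : EdgeSet G) →
    ⟨ lincomb G B c , D ⟩ ≡ ⨁ (λ i → c i ∧ ⟨ B i , D ⟩)
  ⟨lincomb,⟩ {zero}  B c D = ⨁-false (m G)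
  ⟨lincomb,⟩ {suc k} B c D =
    trans (⟨⟩-xor (λ e → c zero ∧ B zero e) (lincomb G (B ∘ suc) (c ∘ suc)) D)
      (cong₂ _xor_
        (trans (⨁-cong (λ e → ∧-assoc (c zero) (B zero e) (D e))) (⨁-∧ (c zero) (λ e → B zero e ∧ D e)))
        (⟨lincomb,⟩ (B ∘ suc) (c ∘ suc) D))

  lincomb-⨁ : ∀ {k} (B : Fin k → EdgeSet G) (c : Fin k → Bool) e → lincomb G B c e ≡ ⨁ (λ i → c i ∧ B i e)
  lincomb-⨁ {zero}  B c e = refl
  lincomb-⨁ {suc k} B c e = cong ((c zero ∧ B zero e) xor_) (lincomb-⨁ (B ∘ suc) (c ∘ suc) e)

  -- Total oddness without reference to a basis: on the cycle space the pairing is the square of the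
  -- parity functional. A totally odd basis implies it, and it implies both (i) and (iii).
  Multiplicative : Set
  Multiplicative = ∀ S D → IsCycle G S → IsCycle G D → ⟨ S , D ⟩ ≡ ⨁ S ∧ ⨁ D

  -- Every entry of the Gram matrix of the basis is 1, on the diagonal because ⟨S,S⟩ is the parity
  -- of S. Bilinear expansion therefore gives the product of the two coefficient sums, and these are
  -- the parities of S and D since all basis elements are odd.
  totallyOddBasis⇒multiplicative : {B : Fin k → EdgeSet G} →
    IsCycleBasis G B → IsTotallyOddFamily G B → Multiplicative
  totallyOddBasis⇒multiplicative {B = B} (_ , _ , spans) (odd , sharedOdd) S D S-cycle D-cycle
    with spans S S-cycle | spans D D-cycle
  ... | c , S≗ | d , D≗ = begin
    ⟨ S , D ⟩                      ≡⟨ ⟨⟩-cong (sym ∘ S≗) (λ _ → refl) ⟩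
    ⟨ lincomb G B c , D ⟩          ≡⟨ ⟨lincomb,⟩ B c D ⟩
    ⨁ (λ i → c i ∧ ⟨ B i , D ⟩)    ≡⟨ ⨁-cong (λ i → trans (cong (c i ∧_) (row i)) (∧-comm (c i) (⨁ d))) ⟩
    ⨁ (λ i → ⨁ d ∧ c i)            ≡⟨ ⨁-∧ (⨁ d) c ⟩
    ⨁ d ∧ ⨁ c                      ≡⟨ ∧-comm (⨁ d) (⨁ c) ⟩
    ⨁ c ∧ ⨁ d                      ≡⟨ cong₂ _∧_ (sym (parity c S S≗)) (sym (parity d D D≗)) ⟩
    ⨁ S ∧ ⨁ D                      ∎
    where
    open ≡-Reasoning
    all-odd : ∀ i j → ⟨ B i , B j ⟩ ≡ true
    all-odd i j with i ≟ j
    ... | yes refl = trans (⟨⟩-self (B i)) (odd⇒⨁ (B i) (odd i))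
    ... | no  i≢j  = odd⇒⨁ (λ e → B i e ∧ B j e) (sharedOdd i j i≢j)
    row : ∀ i → ⟨ B i , D ⟩ ≡ ⨁ d
    row i = begin
      ⟨ B i , D ⟩                  ≡⟨ ⟨⟩-comm (B i) D ⟩
      ⟨ D , B i ⟩                  ≡⟨ ⟨⟩-cong (sym ∘ D≗) (λ _ → refl) ⟩
      ⟨ lincomb G B d , B i ⟩      ≡⟨ ⟨lincomb,⟩ B d (B i) ⟩
      ⨁ (λ j → d j ∧ ⟨ B j , B i ⟩) ≡⟨ ⨁-cong (λ j → trans (cong (d j ∧_) (all-odd j i)) (∧-identityʳ (d j))) ⟩
      ⨁ d                          ∎
    parity : ∀ (x : Fin _ → Bool) X → (∀ e → lincomb G B x e ≡ X e) → ⨁ X ≡ ⨁ x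
    parity x X X≗ = begin
      ⨁ X                          ≡⟨ ⨁-cong (λ e → trans (sym (X≗ e)) (sym (∧-identityʳ _))) ⟩
      -- Parity is the pairing with the all-ones vector, so the expansion of the pairing applies to
      -- it.
      ⟨ lincomb G B x , (λ _ → true) ⟩ ≡⟨ ⟨lincomb,⟩ B x _ ⟩
      ⨁ (λ i → x i ∧ ⟨ B i , (λ _ → true) ⟩) ≡⟨ ⨁-cong (λ i → trans (cong (x i ∧_) (trans (⨁-cong (λ e → ∧-identityʳ (B i e))) (odd⇒⨁ (B i) (odd i)))) (∧-identityʳ (x i))) ⟩
      ⨁ x                          ∎

  multiplicative⇒everyOddCycleBasisTotallyOdd : Multiplicative → EveryOddCycleBasisTotallyOdd G
  multiplicative⇒everyOddCycleBasisTotallyOdd mult k B (cycles , _) odd =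
    odd , λ i j _ → ⨁⇒odd (λ e → B i e ∧ B j e) (trans (mult (B i) (B j) (cycles i) (cycles j)) (cong₂ _∧_ (odd⇒⨁ (B i) (odd i)) (odd⇒⨁ (B j) (odd j))))

  InSpan : (Fin k → EdgeSet G) → EdgeSet G → Set
  InSpan {k} B S = Σ (Fin k → Bool) (λ c → ∀ e → lincomb G B c e ≡ S e)

  lincomb-xor : (B : Fin k → EdgeSet G) (c d : Fin k → Bool) → ∀ e →
    lincomb G B (λ i → c i xor d i) e ≡ lincomb G B c e xor lincomb G B d e
  lincomb-xor {zero}  B c d e = refl
  lincomb-xor {suc k} B c d e =
    trans (cong₂ _xor_ (∧-distribʳ-xor (B zero e) (c zero) (d zero)) (lincomb-xor (B ∘ suc) (c ∘ suc) (d ∘ suc) e))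
          (xor-interchange (c zero ∧ B zero e) (d zero ∧ B zero e) _ _)

  lincomb-false : (B : Fin k → EdgeSet G) → ∀ e → lincomb G B (λ _ → false) e ≡ false
  lincomb-false {zero}  B e = refl
  lincomb-false {suc k} B e = lincomb-false (B ∘ suc) e

  inSpan-false : (B : Fin k → EdgeSet G) → InSpan B (λ _ → false)
  inSpan-false B = (λ _ → false) , lincomb-false B

  inSpan-xor : {B : Fin k → EdgeSet G} {S D : EdgeSet G} → InSpan B S → InSpan B D → InSpan B (λ e → S e xor D e)
  inSpan-xor {B = B} (c , S≗) (d , D≗) = (λ i → c i xor d i) , λ e → trans (lincomb-xor B c d e) (cong₂ _xor_ (S≗ e) (D≗ e))

  inSpan-cong : {B : Fin k → EdgeSet G} {S D : EdgeSet G} → (∀ e → S e ≡ D e) → InSpan B S → InSpan B D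
  inSpan-cong S≗D (c , S≗) = c , λ e → trans (S≗ e) (S≗D e)

  inSpan-lincomb : {B : Fin l → EdgeSet G} (Z : Fin k → EdgeSet G) (c : Fin k → Bool) →
    (∀ i → InSpan B (Z i)) → InSpan B (lincomb G Z c)
  inSpan-lincomb {k = zero}  {B} Z c Z∈ = inSpan-false B
  inSpan-lincomb {k = suc k} {B} Z c Z∈ = inSpan-xor (scaled (c zero)) (inSpan-lincomb (Z ∘ suc) (c ∘ suc) (Z∈ ∘ suc))
    where
    scaled : ∀ b → InSpan B (λ e → b ∧ Z zero e)
    scaled true  = Z∈ zero
    scaled false = inSpan-false B

  -- By cases on the first coefficient, S is in the span of B exactly if S or B₀ + S is in the span
  -- of the remaining vectors. This decision is what allows a basis to be selected constructively.
  inSpan? : (B : Fin k → EdgeSet G) (S : EdgeSet G) → Dec (InSpan B S)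
  inSpan? {zero}  B S = map′ (λ eq → (λ ()) , sym ∘ eq) (λ (_ , eq) → sym ∘ eq) (all? (λ e → S e ≟ᵇ false))
  inSpan? {suc k} B S with inSpan? (B ∘ suc) S | inSpan? (B ∘ suc) (λ e → B zero e xor S e)
  ... | yes (c , eq) | _            = yes ((λ { zero → false ; (suc i) → c i }) , eq)
  ... | no _         | yes (c , eq) =
    yes ((λ { zero → true ; (suc i) → c i }) , λ e → trans (cong (B zero e xor_) (eq e)) (xor-cancelˡ (B zero e) (S e)))
  ... | no S∉        | no S+B₀∉     = no λ (c , eq) → refute c (c zero) eq
    where
    -- The leading coefficient is a separate argument `b`, so that it can be matched on while the
    -- equation follows.
    refute : ∀ (c : Fin (suc k) → Bool) b →
      ¬ (∀ e → (b ∧ B zero e) xor lincomb G (B ∘ suc) (c ∘ suc) e ≡ S e)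
    refute c false eq = S∉ (c ∘ suc , eq)
    refute c true  eq = S+B₀∉ (c ∘ suc , λ e → trans (sym (xor-cancelˡ (B zero e) _)) (cong (B zero e xor_) (eq e)))

  -- Selecting a basis from a generating set

  record IndependentFamily (P : EdgeSet G → Set) : Set where
    field
      size        : ℕ
      member      : Fin size → EdgeSet G
      satisfies   : ∀ i → P (member i)
      independent : LinIndep G member

  -- The span of `P` presented inductively, with no indexed family to carry along. Equality is
  -- pointwise, so sums need only agree edge by edge.
  data Generated (P : EdgeSet G → Set) (S : EdgeSet G) : Set where
    none : (∀ e → S e ≡ false) → Generated P S
    add  : ∀ {X D} → P X → Generated P D → (∀ e → X e xor D e ≡ S e) → Generated P S

  module _ {P : EdgeSet G → Set} where

    generated-cong : ∀ {S D} → (∀ e → S e ≡ D e) → Generated P S → Generated P D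
    generated-cong S≗D (none S≗)    = none (λ e → trans (sym (S≗D e)) (S≗ e))
    generated-cong S≗D (add p g S≗) = add p g (λ e → trans (S≗ e) (S≗D e))

    generated-xor : ∀ {S D} → Generated P S → Generated P D → Generated P (λ e → S e xor D e)
    generated-xor {D = D} (none S≗) h = generated-cong (λ e → sym (cong (_xor D e) (S≗ e))) h
    generated-xor {D = D} (add {X} {S′} p g S≗) h =
      add p (generated-xor g h) (λ e → trans (sym (xor-assoc (X e) (S′ e) (D e))) (cong (_xor D e) (S≗ e)))

    open IndependentFamily

    _⊑_ : IndependentFamily P → IndependentFamily P → Set
    F ⊑ F′ = ∀ {S} → InSpan (member F) S → InSpan (member F′) S

    -- A vector in the span changes nothing, and a vector outside it can be adjoined without
    -- destroying independence.
    insert : ∀ F {X} → P X → Σ (IndependentFamily P) (λ F′ → F ⊑ F′ × InSpan (member F′) X)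
    insert F {X} p with inSpan? (member F) X
    ... | yes X∈ = F , id , X∈
    ... | no  X∉ = F′ , (λ (c , eq) → false ∷ᵛ c , eq) ,
                   true ∷ᵛ (λ _ → false) , λ e → trans (cong (X e xor_) (lincomb-false (member F) e)) (xor-identityʳ (X e))
      where
      independent′ : ∀ c b → (∀ e → (b ∧ X e) xor lincomb G (member F) (c ∘ suc) e ≡ false) →
        b ≡ c zero → ∀ i → c i ≡ false
      independent′ c false eq b≡ zero    = sym b≡
      independent′ c false eq b≡ (suc i) = independent F (c ∘ suc) eq i
      -- A relation in which `X` occurs would express `X` through the family, against `X∉`.
      independent′ c true  eq b≡ i       =
        ⊥-elim (X∉ (c ∘ suc , λ e → trans (sym (xor-cancelˡ (X e) _)) (trans (cong (X e xor_) (eq e)) (xor-identityʳ (X e)))))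
      F′ : IndependentFamily P
      F′ = record
        { size        = suc (size F)
        ; member      = X ∷ᵛ member F
        ; satisfies   = λ { zero → p ; (suc i) → satisfies F i }
        ; independent = λ c eq → independent′ c (c zero) eq refl
        }

    absorb : ∀ F {S} → Generated P S → Σ (IndependentFamily P) (λ F′ → F ⊑ F′ × InSpan (member F′) S)
    absorb F (none S≗) = F , id , inSpan-cong (sym ∘ S≗) (inSpan-false (member F))
    absorb F (add p g S≗) with absorb F g
    ... | F₁ , F⊑F₁ , D∈ with insert F₁ p
    ... | F₂ , F₁⊑F₂ , X∈ = F₂ , F₁⊑F₂ ∘ F⊑F₁ , inSpan-cong S≗ (inSpan-xor X∈ (F₁⊑F₂ D∈))

    -- Starting from the empty family, the summands of each `Z i` are inserted one by one. Applied
    -- to closed walks that span the cycle space, this turns generation by odd circuits into a basis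
    -- of odd circuits.
    absorbAll : (Z : Fin k → EdgeSet G) → (∀ i → Generated P (Z i)) →
      Σ (IndependentFamily P) (λ F → ∀ i → InSpan (member F) (Z i))
    absorbAll {zero}  Z g = record { size = 0 ; member = λ () ; satisfies = λ () ; independent = λ _ _ () } , λ ()
    absorbAll {suc k} Z g with absorbAll (Z ∘ suc) (g ∘ suc)
    ... | F₁ , Z∈ with absorb F₁ (g zero)
    ... | F₂ , F₁⊑F₂ , Z₀∈ = F₂ , λ { zero → Z₀∈ ; (suc i) → F₁⊑F₂ (Z∈ i) }

-- Walks

unique-tail : {x : A} {xs : List A} → Unique (x ∷ xs) → Unique xs
unique-tail (_ ∷ u) = u

unique-∷ : {x : A} {xs : List A} → x ∉ xs → Unique xs → Unique (x ∷ xs)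
unique-∷ x∉ u = ¬Any⇒All¬ _ x∉ ∷ u

unique-++⁻ : (xs : List A) {ys : List A} → Unique (xs ++ ys) → Unique xs × Unique ys × Disjoint xs ys
unique-++⁻ []       u = [] , u , λ ()
unique-++⁻ (x ∷ xs) u@(_ ∷ u′) with unique-++⁻ xs u′
... | uxs , uys , disj =
  unique-∷ (x∉ ∘ ∈-++⁺ˡ) uxs , uys , λ { (here refl , y∈) → x∉ (∈-++⁺ʳ xs y∈) ; (there x∈ , y∈) → disj (x∈ , y∈) }
  where x∉ = Unique[x∷xs]⇒x∉xs u

unique-resp-↭ : {xs ys : List A} → xs ↭ ys → Unique xs → Unique ys
unique-resp-↭ {A = A} p = Permutation.Unique-resp-↭ (setoid A) (↭⇒↭ₛ p)

module Walks (G : Graph) where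

  private variable
    u v w t x : Vertex G

  incident-xor : ∀ e v → incident G e v ≡ does (src G e ≟ v) xor does (tgt G e ≟ v)
  incident-xor e v with src G e ≟ v | tgt G e ≟ v
  ... | yes refl | yes t≡v = ⊥-elim (noLoop G e (sym t≡v))
  ... | yes _    | no _    = refl
  ... | no _     | _       = refl

  -- F (src e) + F (tgt e) is expanded as a sum over all vertices, which then occur with their degree in S.
  cycle⊥cut : ∀ S → IsCycle G S → (F : Vertex G → Bool) → ⨁ (λ e → S e ∧ (F (src G e) xor F (tgt G e))) ≡ false
  cycle⊥cut S cyc F = begin
    ⨁ (λ e → S e ∧ (F (src G e) xor F (tgt G e)))                  ≡⟨ ⨁-cong expand ⟩
    ⨁ (λ e → ⨁ (λ v → F v ∧ (S e ∧ incident G e v)))              ≡⟨ ⨁-swap (λ e v → F v ∧ (S e ∧ incident G e v)) ⟩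
    ⨁ (λ v → ⨁ (λ e → F v ∧ (S e ∧ incident G e v)))              ≡⟨ ⨁-cong vanish ⟩
    ⨁ {n G} (λ _ → false)                                          ≡⟨ ⨁-false (n G) ⟩
    false                                                          ∎
    where
    open ≡-Reasoning
    expand : ∀ e → S e ∧ (F (src G e) xor F (tgt G e)) ≡ ⨁ (λ v → F v ∧ (S e ∧ incident G e v))
    expand e = begin
      S e ∧ (F (src G e) xor F (tgt G e))
        ≡⟨ cong (S e ∧_) (sym (cong₂ _xor_ (⨁-δ (src G e) F) (⨁-δ (tgt G e) F))) ⟩
      S e ∧ (⨁ (λ v → does (src G e ≟ v) ∧ F v) xor ⨁ (λ v → does (tgt G e ≟ v) ∧ F v))
        ≡⟨ cong (S e ∧_) (sym (⨁-xor (λ v → does (src G e ≟ v) ∧ F v) (λ v → does (tgt G e ≟ v) ∧ F v))) ⟩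
      S e ∧ ⨁ (λ v → (does (src G e ≟ v) ∧ F v) xor (does (tgt G e ≟ v) ∧ F v))
        ≡⟨ sym (⨁-∧ (S e) (λ v → (does (src G e ≟ v) ∧ F v) xor (does (tgt G e ≟ v) ∧ F v))) ⟩
      ⨁ (λ v → S e ∧ ((does (src G e ≟ v) ∧ F v) xor (does (tgt G e ≟ v) ∧ F v)))
        ≡⟨ ⨁-cong (λ v → trans (cong (S e ∧_) (trans (sym (∧-distribʳ-xor (F v) (does (src G e ≟ v)) (does (tgt G e ≟ v)))) (cong (_∧ F v) (sym (incident-xor e v))))) (rotate (S e) (incident G e v) (F v))) ⟩
      ⨁ (λ v → F v ∧ (S e ∧ incident G e v)) ∎
      where
      rotate : ∀ a b c → a ∧ (b ∧ c) ≡ c ∧ (a ∧ b)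
      rotate a b c = trans (sym (∧-assoc a b c)) (∧-comm (a ∧ b) c)
    vanish : ∀ v → ⨁ (λ e → F v ∧ (S e ∧ incident G e v)) ≡ false
    vanish v = trans (⨁-∧ (F v) (λ e → S e ∧ incident G e v))
      (trans (cong (F v ∧_) (even⇒⨁ (λ e → S e ∧ incident G e v) (cyc v))) (∧-zeroʳ (F v)))

  -- Repetitions are allowed, so concatenation and reversal are total; a path is a walk `p` together
  -- with `Unique (vertices p)`.
  data Walk : Vertex G → Vertex G → Set where
    nil  : Walk u u
    cons : (e : Edge G) → Joins G e u w → Walk w v → Walk u v

  -- The first vertex is left out, so that a closed walk lists its base vertex only once.
  tails : Walk u v → List (Vertex G)
  tails nil                  = []
  tails (cons {w = w} e j p) = w ∷ tails p

  vertices : Walk u v → List (Vertex G)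
  vertices {u} p = u ∷ tails p

  edges : Walk u v → List (Edge G)
  edges nil          = []
  edges (cons e j p) = e ∷ edges p

  parity : Walk u v → Bool
  parity nil          = false
  parity (cons e j p) = not (parity p)

  -- Multiplicities are taken mod 2, which makes concatenation additive. It is the indicator of
  -- `edges` only when no edge repeats.
  edgeVector : Walk u v → EdgeSet G
  edgeVector nil          f = false
  edgeVector (cons e j p) f = does (e ≟ f) xor edgeVector p f

  infixr 5 _++ʷ_
  _++ʷ_ : Walk u v → Walk v w → Walk u w
  nil        ++ʷ q = q
  cons e j p ++ʷ q = cons e j (p ++ʷ q)

  joins-sym : ∀ {e} → Joins G e u v → Joins G e v u
  joins-sym (inj₁ j) = inj₂ j
  joins-sym (inj₂ j) = inj₁ j

  rev : Walk u v → Walk v u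
  rev nil          = nil
  rev (cons e j p) = rev p ++ʷ cons e (joins-sym j) nil

  tails-++ : (p : Walk u v) (q : Walk v w) → tails (p ++ʷ q) ≡ tails p ++ tails q
  tails-++ nil          q = refl
  tails-++ (cons e j p) q = cong (_ ∷_) (tails-++ p q)

  edges-++ : (p : Walk u v) (q : Walk v w) → edges (p ++ʷ q) ≡ edges p ++ edges q
  edges-++ nil          q = refl
  edges-++ (cons e j p) q = cong (e ∷_) (edges-++ p q)

  parity-++ : (p : Walk u v) (q : Walk v w) → parity (p ++ʷ q) ≡ parity p xor parity q
  parity-++ nil          q = refl
  parity-++ (cons e j p) q = trans (cong not (parity-++ p q)) (not-distribˡ-xor (parity p) (parity q))

  edgeVector-++ : (p : Walk u v) (q : Walk v w) → ∀ f → edgeVector (p ++ʷ q) f ≡ edgeVector p f xor edgeVector q f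
  edgeVector-++ nil          q f = refl
  edgeVector-++ (cons e j p) q f =
    trans (cong (does (e ≟ f) xor_) (edgeVector-++ p q f)) (sym (xor-assoc (does (e ≟ f)) (edgeVector p f) (edgeVector q f)))

  ++ʷ-assoc : (p : Walk u v) (q : Walk v w) (r : Walk w x) → (p ++ʷ q) ++ʷ r ≡ p ++ʷ (q ++ʷ r)
  ++ʷ-assoc nil          q r = refl
  ++ʷ-assoc (cons e j p) q r = cong (cons e j) (++ʷ-assoc p q r)

  -- A permutation is enough, since membership and uniqueness are all that is asked of these lists.
  vertices-rev : (p : Walk u v) → vertices (rev p) ↭ vertices p
  vertices-rev nil = ↭-refl
  vertices-rev {u} {v} (cons e j p) rewrite tails-++ (rev p) (cons e (joins-sym j) nil) =
    ↭-trans (↭-sym (∷↭∷ʳ u (v ∷ tails (rev p)))) (prep u (vertices-rev p))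

  edges-rev : (p : Walk u v) → edges (rev p) ↭ edges p
  edges-rev nil = ↭-refl
  edges-rev (cons e j p) rewrite edges-++ (rev p) (cons e (joins-sym j) nil) =
    ↭-trans (↭-sym (∷↭∷ʳ e (edges (rev p)))) (prep e (edges-rev p))

  parity-rev : (p : Walk u v) → parity (rev p) ≡ parity p
  parity-rev nil = refl
  parity-rev (cons e j p) =
    trans (parity-++ (rev p) (cons e (joins-sym j) nil)) (trans (xor-comm (parity (rev p)) true) (cong not (parity-rev p)))

  edgeVector-rev : (p : Walk u v) → ∀ f → edgeVector (rev p) f ≡ edgeVector p f
  edgeVector-rev nil          f = refl
  edgeVector-rev (cons e j p) f =
    trans (edgeVector-++ (rev p) (cons e (joins-sym j) nil) f)
      (trans (cong₂ _xor_ (edgeVector-rev p f) (xor-identityʳ (does (e ≟ f)))) (xor-comm (edgeVector p f) (does (e ≟ f))))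

  split : (p : Walk u v) → t ∈ vertices p → ∃₂ λ (p₁ : Walk u t) (p₂ : Walk t v) → p ≡ p₁ ++ʷ p₂
  split p            (here refl) = nil , p , refl
  split (cons e j p) (there t∈)  with split p t∈
  ... | p₁ , p₂ , refl = cons e j p₁ , p₂ , refl

  end∈vertices : (p : Walk u v) → v ∈ vertices p
  end∈vertices nil          = here refl
  end∈vertices (cons e j p) = there (end∈vertices p)

  end∈tails : u ≢ v → (p : Walk u v) → v ∈ tails p
  end∈tails u≢v p with end∈vertices p
  ... | here refl = ⊥-elim (u≢v refl)
  ... | there v∈  = v∈

  -- A nonempty closed walk returns to its base, which then occurs among its tails.
  closedPath-nil : (p : Walk v v) → v ∉ tails p → p ≡ nil
  closedPath-nil nil          v∉ = refl
  closedPath-nil (cons e j p) v∉ = ⊥-elim (v∉ (end∈vertices p))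

  joins-≢ : ∀ {e} → Joins G e u v → u ≢ v
  joins-≢ {e = e} (inj₁ (refl , refl)) = noLoop G e
  joins-≢ {e = e} (inj₂ (refl , refl)) = noLoop G e ∘ sym

  joins-ends : ∀ {e} {P : Vertex G → Set} → Joins G e u v → P u → P v → P (src G e) × P (tgt G e)
  joins-ends (inj₁ (refl , refl)) pu pv = pu , pv
  joins-ends (inj₂ (refl , refl)) pu pv = pv , pu

  ends∈vertices : ∀ {e} (p : Walk u v) → e ∈ edges p → src G e ∈ vertices p × tgt G e ∈ vertices p
  ends∈vertices (cons e j p) (here refl) = joins-ends {P = _∈ vertices (cons e j p)} j (here refl) (there (here refl))
  ends∈vertices (cons e j p) (there e∈)  with ends∈vertices p e∈
  ... | s∈ , t∈ = there s∈ , there t∈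

  joined∈vertices : ∀ {e} (p : Walk u v) → e ∈ edges p → Joins G e w t → w ∈ vertices p
  joined∈vertices p e∈ (inj₁ (refl , refl)) = proj₁ (ends∈vertices p e∈)
  joined∈vertices p e∈ (inj₂ (refl , refl)) = proj₂ (ends∈vertices p e∈)

  -- If the first edge occurred again, the start of the path would be a vertex of the rest.
  path-edges-unique : (p : Walk u v) → Unique (vertices p) → Unique (edges p)
  path-edges-unique nil          un = []
  path-edges-unique (cons e j p) un =
    unique-∷ (λ e∈ → Unique[x∷xs]⇒x∉xs un (joined∈vertices p e∈ j)) (path-edges-unique p (unique-tail un))

  -- The common vertex `v` is counted with the first piece, hence the asymmetry between `vertices p`
  -- and `tails q`.
  path-++⁻ : (p : Walk u v) (q : Walk v w) → Unique (vertices (p ++ʷ q)) →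
    Unique (vertices p) × Unique (vertices q) × Disjoint (vertices p) (tails q)
  path-++⁻ {u} {v} p q un with unique-++⁻ (vertices p) (subst (λ xs → Unique (u ∷ xs)) (tails-++ p q) un)
  ... | up , uq , disj = up , unique-∷ (λ v∈ → disj (end∈vertices p , v∈)) uq , disj

  path-rev : (p : Walk u v) → Unique (vertices p) → Unique (vertices (rev p))
  path-rev p = unique-resp-↭ (↭-sym (vertices-rev p))

  Proper : (Vertex G → Bool) → Edge G → Set
  Proper F e = F (src G e) xor F (tgt G e) ≡ true

  joins-xor : ∀ {e} (F : Vertex G → Bool) → Joins G e u v → F (src G e) xor F (tgt G e) ≡ F u xor F v
  joins-xor F (inj₁ (refl , refl)) = refl
  joins-xor {e = e} F (inj₂ (refl , refl)) = xor-comm (F (src G e)) (F (tgt G e))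

  -- Every edge flips the colour, so the sum of colour changes telescopes.
  proper-parity : (F : Vertex G → Bool) (p : Walk u v) → (∀ {e} → e ∈ edges p → Proper F e) → parity p ≡ F u xor F v
  proper-parity {u} F nil prop = sym (xor-same (F u))
  proper-parity {u} {v} F (cons {w = w} e j p) prop = begin
    not (parity p)                  ≡⟨ cong not (proper-parity F p (prop ∘ there)) ⟩
    true xor (F w xor F v)          ≡⟨ cong (_xor (F w xor F v)) (trans (sym (prop (here refl))) (joins-xor F j)) ⟩
    (F u xor F w) xor (F w xor F v) ≡⟨ xor-assoc (F u) (F w) _ ⟩
    F u xor (F w xor (F w xor F v)) ≡⟨ cong (F u xor_) (xor-cancelˡ (F w) (F v)) ⟩
    F u xor F v                     ∎
    where open ≡-Reasoning

  ∈edges : (p : Walk u v) → ∀ {f} → edgeVector p f ≡ true → f ∈ edges p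
  ∈edges (cons e j p) {f} eq with e ≟ f
  ... | yes refl = here refl
  ... | no  _    = there (∈edges p eq)

  edgeVector-∉ : (p : Walk u v) → ∀ {f} → f ∉ edges p → edgeVector p f ≡ false
  edgeVector-∉ p {f} f∉ with edgeVector p f in eq
  ... | false = refl
  ... | true  = ⊥-elim (f∉ (∈edges p eq))

  edgeVector-∈ : (p : Walk u v) → Unique (edges p) → ∀ {f} → f ∈ edges p → edgeVector p f ≡ true
  edgeVector-∈ (cons e j p) un (here refl) =
    cong₂ _xor_ (dec-true (e ≟ e) refl) (edgeVector-∉ p (Unique[x∷xs]⇒x∉xs un))
  edgeVector-∈ (cons e j p) un {f} (there f∈) =
    cong₂ _xor_ (dec-false (e ≟ f) λ { refl → Unique[x∷xs]⇒x∉xs un f∈ }) (edgeVector-∈ p (unique-tail un) f∈)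

  -- The weight `h` lets one recursion serve both the parity of a walk, with constant weight, and
  -- its boundary, with incidence as weight.
  ⨁-edgeVector : (p : Walk u v) (h : Edge G → Bool) → ∀ {e} (j : Joins G e w u) →
    ⨁ (λ f → edgeVector (cons e j p) f ∧ h f) ≡ h e xor ⨁ (λ f → edgeVector p f ∧ h f)
  ⨁-edgeVector p h {e} j =
    trans (⨁-cong (λ f → ∧-distribʳ-xor (h f) (does (e ≟ f)) (edgeVector p f)))
      (trans (⨁-xor (λ f → does (e ≟ f) ∧ h f) (λ f → edgeVector p f ∧ h f))
        (cong (_xor _) (⨁-δ e h)))

  ⨁-edgeVector≡parity : (p : Walk u v) → ⨁ (edgeVector p) ≡ parity p
  ⨁-edgeVector≡parity p = trans (⨁-cong (λ e → sym (∧-identityʳ (edgeVector p e)))) (go p)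
    where
    go : (p : Walk u v) → ⨁ (λ e → edgeVector p e ∧ true) ≡ parity p
    go nil          = ⨁-false (m G)
    go (cons e j p) = trans (⨁-edgeVector p (λ _ → true) j) (cong not (go p))

  -- The mod 2 boundary telescopes: each visit to an intermediate vertex is counted twice.
  boundary : (p : Walk u v) → ∀ x → ⨁ (λ e → edgeVector p e ∧ incident G e x) ≡ does (u ≟ x) xor does (v ≟ x)
  boundary {u} nil x = trans (⨁-false (m G)) (sym (xor-same (does (u ≟ x))))
  boundary {u} {v} (cons {w = w} e j p) x = begin
    ⨁ (λ f → edgeVector (cons e j p) f ∧ incident G f x)     ≡⟨ ⨁-edgeVector p (λ f → incident G f x) j ⟩
    incident G e x xor ⨁ (λ f → edgeVector p f ∧ incident G f x)
      ≡⟨ cong₂ _xor_ (trans (incident-xor e x) (joins-xor (λ y → does (y ≟ x)) j)) (boundary p x) ⟩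
    (does (u ≟ x) xor does (w ≟ x)) xor (does (w ≟ x) xor does (v ≟ x)) ≡⟨ xor-assoc (does (u ≟ x)) (does (w ≟ x)) _ ⟩
    does (u ≟ x) xor (does (w ≟ x) xor (does (w ≟ x) xor does (v ≟ x))) ≡⟨ cong (does (u ≟ x) xor_) (xor-cancelˡ (does (w ≟ x)) _) ⟩
    does (u ≟ x) xor does (v ≟ x) ∎
    where open ≡-Reasoning

  closedWalk-isCycle : (p : Walk u u) → IsCycle G (edgeVector p)
  closedWalk-isCycle {u} p x = ⨁⇒even (λ e → edgeVector p e ∧ incident G e x) (trans (boundary p x) (xor-same (does (u ≟ x))))

-- Ears

module Ears (G : Graph) (T : EdgeSet G) where

  open Walks G
  open DecMembership (_≟_ {n G}) using (_∈?_)

  private variable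
    u v w t s x a b : Vertex G
    W : Vertex G → Bool
    F F′ : Vertex G → Bool

  -- The start is not among the tails, so `inner∉` has to except only `v`. The field `edges∉`
  -- prevents an edge of `T` between two vertices of `W` from being an ear.
  record Ear (W : Vertex G → Bool) (u v : Vertex G) : Set where
    field
      walk   : Walk u v
      start∈ : W u ≡ true
      end∈   : W v ≡ true
      unique : Unique (vertices walk)
      inner∉ : ∀ {t} → t ∈ tails walk → W t ≡ true → t ≡ v
      edges∉ : ∀ {e} → e ∈ edges walk → T e ≡ false
      u≢v    : u ≢ v

  open Ear

  BadEar : (W F : Vertex G → Bool) → Set
  BadEar W F = ∃₂ λ u v → Σ[ E ∈ Ear W u v ] parity (walk E) ≢ F u xor F v

  Extension : (W F : Vertex G → Bool) → Set
  Extension W F = Σ[ F′ ∈ (Vertex G → Bool) ] (∀ v → W v ≡ true → F′ v ≡ F v) × (∀ e → T e ≡ false → Proper F′ e)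

  -- Only the colours of the two ends enter, and both ends lie in `W`.
  badEar-cong : (∀ t → W t ≡ true → F′ t ≡ F t) → BadEar W F′ → BadEar W F
  badEar-cong F≗ (u , v , E , bad) =
    u , v , E , λ eq → bad (trans eq (sym (cong₂ _xor_ (F≗ u (start∈ E)) (F≗ v (end∈ E)))))

  -- Prolonging the ears of an enlarged set

  module Prolong {W W′ F : Vertex G → Bool} {u v : Vertex G} (P : Ear W u v)
    (proper : ∀ {e} → e ∈ edges (walk P) → Proper F e)
    (W⊆W′   : ∀ {t} → W t ≡ true → W′ t ≡ true)
    (P⊆W′   : ∀ {t} → t ∈ vertices (walk P) → W′ t ≡ true)
    (W′⊆    : ∀ t → W′ t ≡ true → W t ≡ true ⊎ (W t ≡ false × t ∈ vertices (walk P)))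
    where

    -- The pieces of P by which an ear of W′ with end s is prolonged to an ear of W.
    record Arm (a s : Vertex G) : Set where
      field
        arm      : Walk a s
        base∈    : W a ≡ true
        path     : Unique (vertices arm)
        ⊆W′      : ∀ {t} → t ∈ vertices arm → W′ t ≡ true
        base     : ∀ {t} → t ∈ vertices arm → W t ≡ true → t ≡ a
        off      : ∀ {e} → e ∈ edges arm → T e ≡ false
        properly : ∀ {e} → e ∈ edges arm → Proper F e

    open Arm

    trivialArm : W s ≡ true → Arm s s
    trivialArm s∈ = record
      { arm = nil ; base∈ = s∈ ; path = [] ∷ [] ; ⊆W′ = λ { (here refl) → W⊆W′ s∈ }
      ; base = λ { (here eq) _ → eq } ; off = λ () ; properly = λ () }

    -- The returned equation records which piece of `P` the arm is; the disjointness of two arms is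
    -- read off from it.
    leftArm : W t ≡ false → (p₁ : Walk u t) (p₂ : Walk t v) → walk P ≡ p₁ ++ʷ p₂ →
      Σ[ R ∈ Arm u t ] arm R ≡ p₁
    leftArm {t} t∉ p₁ p₂ eq = record
      { arm    = p₁
      ; base∈  = start∈ P
      ; path   = proj₁ pieces
      ; ⊆W′    = P⊆W′ ∘ inP
      -- A later vertex in `W` would be `v`, which belongs to the other piece.
      ; base   = λ { (here eq) _ → eq ; x∈@(there x∈t) Wx → ⊥-elim (proj₂ (proj₂ pieces) (x∈ , subst (_∈ tails p₂) (sym (inner∉ P (inTails x∈t) Wx)) v∈)) }
      ; off    = edges∉ P ∘ inEdges
      ; properly = proper ∘ inEdges
      } , refl
      where
      inTails : ∀ {x} → x ∈ tails p₁ → x ∈ tails (walk P)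
      inTails {x} x∈ = subst (x ∈_) (sym (trans (cong tails eq) (tails-++ p₁ p₂))) (∈-++⁺ˡ x∈)
      inP : ∀ {x} → x ∈ vertices p₁ → x ∈ vertices (walk P)
      inP (here eq)  = here eq
      inP (there x∈) = there (inTails x∈)
      inEdges : ∀ {e} → e ∈ edges p₁ → e ∈ edges (walk P)
      inEdges {e} e∈ = subst (e ∈_) (sym (trans (cong edges eq) (edges-++ p₁ p₂))) (∈-++⁺ˡ e∈)
      pieces = path-++⁻ p₁ p₂ (subst (Unique ∘ vertices) eq (unique P))
      v∈ : v ∈ tails p₂
      v∈ = end∈tails (λ { refl → true≢false (trans (sym (end∈ P)) t∉) }) p₂

    rightArm : W t ≡ false → (p₁ : Walk u t) (p₂ : Walk t v) → walk P ≡ p₁ ++ʷ p₂ →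
      Σ[ R ∈ Arm v t ] arm R ≡ rev p₂
    rightArm {t} t∉ p₁ p₂ eq = record
      { arm    = rev p₂
      ; base∈  = end∈ P
      ; path   = path-rev p₂ (proj₁ (proj₂ pieces))
      ; ⊆W′    = P⊆W′ ∘ inP ∘ unrev
      ; base   = λ x∈ Wx → base′ (unrev x∈) Wx
      ; off    = edges∉ P ∘ inEdges
      ; properly = proper ∘ inEdges
      } , refl
      where
      unrev : ∀ {x} → x ∈ vertices (rev p₂) → x ∈ vertices p₂
      unrev = ∈-resp-↭ (vertices-rev p₂)
      inTails : ∀ {x} → x ∈ tails p₂ → x ∈ tails (walk P)
      inTails {x} x∈ = subst (x ∈_) (sym (trans (cong tails eq) (tails-++ p₁ p₂))) (∈-++⁺ʳ (tails p₁) x∈)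
      inP : ∀ {x} → x ∈ vertices p₂ → x ∈ vertices (walk P)
      inP (there x∈)  = there (inTails x∈)
      inP (here refl) with end∈vertices p₁
      ... | here eq  = here eq
      ... | there x∈ = there (subst (t ∈_) (sym (trans (cong tails eq) (tails-++ p₁ p₂))) (∈-++⁺ˡ x∈))
      inEdges : ∀ {e} → e ∈ edges (rev p₂) → e ∈ edges (walk P)
      inEdges {e} e∈ = subst (e ∈_) (sym (trans (cong edges eq) (edges-++ p₁ p₂))) (∈-++⁺ʳ (edges p₁) (∈-resp-↭ (edges-rev p₂) e∈))
      pieces = path-++⁻ p₁ p₂ (subst (Unique ∘ vertices) eq (unique P))
      base′ : ∀ {x} → x ∈ vertices p₂ → W x ≡ true → x ≡ v
      base′ (here refl) Wx = ⊥-elim (true≢false (trans (sym Wx) t∉))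
      base′ (there x∈)  Wx = inner∉ P (inTails x∈) Wx

    -- Along the arms, parity equals the difference of colours. The discrepancy between parity and
    -- colours is therefore the same for the prolonged ear as for `Q`.
    prolong : (Q : Ear W′ s t) → parity (walk Q) ≢ F s xor F t → (R : Arm a s) (R′ : Arm b t) →
      Disjoint (vertices (arm R)) (vertices (arm R′)) → BadEar W F
    prolong {s} {t} {a} {b} Q bad R R′ disj = a , b , E , bad′
      where
      r = arm R
      q = walk Q
      r′ = rev (arm R′)
      p = r ++ʷ (q ++ʷ r′)
      tails-p : tails p ≡ tails r ++ (tails q ++ tails r′)
      tails-p = trans (tails-++ r (q ++ʷ r′)) (cong (tails r ++_) (tails-++ q r′))
      edges-p : edges p ≡ edges r ++ (edges q ++ edges r′)
      edges-p = trans (edges-++ r (q ++ʷ r′)) (cong (edges r ++_) (edges-++ q r′))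
      unrev : ∀ {x} → x ∈ vertices r′ → x ∈ vertices (arm R′)
      unrev = ∈-resp-↭ (vertices-rev (arm R′))
      path-r′ : Unique (vertices r′)
      path-r′ = path-rev (arm R′) (path R′)
      q-r′ : Disjoint (tails q) (tails r′)
      q-r′ (x∈q , x∈r′) with inner∉ Q x∈q (⊆W′ R′ (unrev (there x∈r′)))
      ... | refl = Unique[x∷xs]⇒x∉xs path-r′ x∈r′
      r-qr′ : Disjoint (tails r) (tails q ++ tails r′)
      r-qr′ (x∈r , x∈) with ∈-++⁻ (tails q) x∈
      ... | inj₂ x∈r′ = disj (there x∈r , unrev (there x∈r′))
      ... | inj₁ x∈q with inner∉ Q x∈q (⊆W′ R (there x∈r))
      ...   | refl = disj (there x∈r , end∈vertices (arm R′))
      inner : ∀ {x} → x ∈ tails p → W x ≡ true → x ≡ b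
      inner {x} x∈ Wx with ∈-++⁻ (tails r) (subst (x ∈_) tails-p x∈)
      ... | inj₁ x∈r with base R (there x∈r) Wx
      ...   | refl = ⊥-elim (Unique[x∷xs]⇒x∉xs (path R) x∈r)
      inner {x} x∈ Wx | inj₂ x∈qr′ with ∈-++⁻ (tails q) x∈qr′
      ... | inj₂ x∈r′ = base R′ (unrev (there x∈r′)) Wx
      ... | inj₁ x∈q with inner∉ Q x∈q (W⊆W′ Wx)
      ...   | refl = base R′ (end∈vertices (arm R′)) Wx
      edges-off : ∀ {e} → e ∈ edges p → T e ≡ false
      edges-off {e} e∈ with ∈-++⁻ (edges r) (subst (e ∈_) edges-p e∈)
      ... | inj₁ e∈r = off R e∈r
      ... | inj₂ e∈qr′ with ∈-++⁻ (edges q) e∈qr′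
      ...   | inj₁ e∈q  = edges∉ Q e∈q
      ...   | inj₂ e∈r′ = off R′ (∈-resp-↭ (edges-rev (arm R′)) e∈r′)
      a≢b : a ≢ b
      a≢b refl = disj (here refl , here refl)
      unique-tails : Unique (tails p)
      unique-tails = subst Unique (sym tails-p)
        (unique-++⁺ (unique-tail (path R)) (unique-++⁺ (unique-tail (unique Q)) (unique-tail path-r′) q-r′) r-qr′)
      E : Ear W a b
      E = record
        { walk   = p
        ; start∈ = base∈ R
        ; end∈   = base∈ R′
        -- `a` lies in `W`, so if it recurred among the tails it would be `b`.
        ; unique = unique-∷ (λ a∈ → a≢b (inner a∈ (base∈ R))) unique-tails
        ; inner∉ = inner
        ; edges∉ = edges-off
        ; u≢v    = a≢b
        }
      -- The first bracket of the result is the colour sum at the new ends, the second is the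
      -- discrepancy of `Q`.
      regroup : ∀ α β σ τ π → (α xor σ) xor (π xor (β xor τ)) ≡ (α xor β) xor (π xor (σ xor τ))
      regroup α β σ τ π = begin
        (α xor σ) xor (π xor (β xor τ)) ≡⟨ cong ((α xor σ) xor_) (xor-left-comm π β τ) ⟩
        (α xor σ) xor (β xor (π xor τ)) ≡⟨ xor-interchange α σ β (π xor τ) ⟩
        (α xor β) xor (σ xor (π xor τ)) ≡⟨ cong ((α xor β) xor_) (xor-left-comm σ π τ) ⟩
        (α xor β) xor (π xor (σ xor τ)) ∎
        where open ≡-Reasoning
      bad′ : parity p ≢ F a xor F b
      bad′ eq = bad (xor-≡false (parity q) _ (xor-fixed (F a xor F b) _
        (trans (sym (regroup (F a) (F b) (F s) (F t) (parity q))) (trans (sym parity-p) eq))))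
        where
        parity-p : parity p ≡ (F a xor F s) xor (parity q xor (F b xor F t))
        parity-p = trans (parity-++ r (q ++ʷ r′)) (cong₂ _xor_ (proper-parity F r (properly R))
          (trans (parity-++ q r′) (cong (parity q xor_) (trans (parity-rev (arm R′)) (proper-parity F (arm R′) (properly R′))))))

    -- `P` meets `W` only in its two distinct ends, and `s` is at most one of them; the arm goes to
    -- the other.
    armAvoiding : W s ≡ true → W t ≡ false → t ∈ vertices (walk P) → ∃[ b ] Σ[ R ∈ Arm b t ] s ∉ vertices (arm R)
    armAvoiding {s} {t} s∈ t∉ t∈ with split (walk P) t∈ | s ≟ u
    ... | p₁ , p₂ , eq | no s≢u   = let R , _ = leftArm t∉ p₁ p₂ eq in u , R , λ s∈R → s≢u (base R s∈R s∈)
    ... | p₁ , p₂ , eq | yes refl = let R , _ = rightArm t∉ p₁ p₂ eq in v , R , λ s∈R → u≢v P (base R s∈R s∈)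

    -- An end of `Q` in `W` gets a trivial arm, an end inside `P` is led along `P` into `W`. If both
    -- lie inside `P`, the one nearer to `u` is led to `u` and the other to `v`, which keeps the
    -- arms disjoint.
    badEar-shrink : BadEar W′ F → BadEar W F
    badEar-shrink (s , t , Q , bad) with W′⊆ s (start∈ Q) | W′⊆ t (end∈ Q)
    ... | inj₁ s∈ | inj₁ t∈ = prolong Q bad (trivialArm s∈) (trivialArm t∈) λ { (here refl , here s≡t) → u≢v Q s≡t }
    ... | inj₁ s∈ | inj₂ (t∉ , t∈P) =
      let b , R , s∉R = armAvoiding s∈ t∉ t∈P in
      prolong Q bad (trivialArm s∈) R λ { (here refl , s∈R) → s∉R s∈R }
    ... | inj₂ (s∉ , s∈P) | inj₁ t∈ =
      let a , R , t∉R = armAvoiding t∈ s∉ s∈P in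
      prolong Q bad R (trivialArm t∈) λ { (t∈R , here refl) → t∉R t∈R }
    ... | inj₂ (s∉ , s∈P) | inj₂ (t∉ , t∈P) with split (walk P) s∈P
    ...   | p₁ , p₂ , eq with path-++⁻ p₁ p₂ (subst (Unique ∘ vertices) eq (unique P))
    ...     | path₁ , path₂ , disj
              with ∈-++⁻ (vertices p₁) (subst (λ ts → t ∈ u ∷ ts) (trans (cong tails eq) (tails-++ p₁ p₂)) t∈P)
    -- Here `t` follows `s` on `P`: `s` is led to `u` and `t` to `v`.
    ...       | inj₂ t∈p₂ with split p₂ (there t∈p₂)
    ...         | p₃ , p₄ , refl =
      let R  , R≡  = leftArm s∉ p₁ p₂ eq
          R′ , R′≡ = rightArm t∉ (p₁ ++ʷ p₃) p₄ (trans eq (sym (++ʷ-assoc p₁ p₃ p₄)))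
      in prolong Q bad R R′ λ {x} (x∈R , x∈R′) →
        disj (subst (λ r → x ∈ vertices r) R≡ x∈R , back (∈-resp-↭ (vertices-rev p₄) (subst (λ r → x ∈ vertices r) R′≡ x∈R′)))
      where
      back : ∀ {x} → x ∈ vertices p₄ → x ∈ tails (p₃ ++ʷ p₄)
      back (here refl) = t∈p₂
      back {x} (there x∈) = subst (x ∈_) (sym (tails-++ p₃ p₄)) (∈-++⁺ʳ (tails p₃) x∈)
    -- Here `t` precedes `s` on `P`, and the roles of the two arms are exchanged.
    badEar-shrink (s , t , Q , bad) | inj₂ (s∉ , s∈P) | inj₂ (t∉ , t∈P) | p₁ , p₂ , eq | path₁ , path₂ , disj | inj₁ t∈p₁ with split p₁ t∈p₁
    ...         | p₃ , p₄ , refl =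
      let R  , R≡  = rightArm s∉ (p₃ ++ʷ p₄) p₂ eq
          R′ , R′≡ = leftArm t∉ p₃ (p₄ ++ʷ p₂) (trans eq (++ʷ-assoc p₃ p₄ p₂))
      in prolong Q bad R R′ λ {x} (x∈R , x∈R′) →
        apart (subst (λ r → x ∈ vertices r) R′≡ x∈R′) (∈-resp-↭ (vertices-rev p₂) (subst (λ r → x ∈ vertices r) R≡ x∈R))
      where
      disj₃₄ = proj₂ (proj₂ (path-++⁻ p₃ p₄ path₁))
      grow : ∀ {x} → x ∈ vertices p₃ → x ∈ vertices (p₃ ++ʷ p₄)
      grow {x} x∈ = subst (λ ts → x ∈ u ∷ ts) (sym (tails-++ p₃ p₄)) (∈-++⁺ˡ x∈)
      apart : ∀ {x} → x ∈ vertices p₃ → x ∈ vertices p₂ → ⊥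
      apart x∈ (here refl) = disj₃₄ (x∈ , end∈tails (u≢v Q ∘ sym) p₄)
      apart x∈ (there x∈p₂) = disj (grow x∈ , x∈p₂)

  -- Colours alternate from `u` onwards, and the parity condition makes the last edge proper.
  -- Uniqueness is asked of the tails only, so that the walk may be a closed one around a circuit;
  -- the premise on `u` then protects the colour of the base.
  colourAlong : (W F : Vertex G → Bool) (p : Walk u v) → Unique (tails p) → W v ≡ true →
    (∀ {t} → t ∈ tails p → W t ≡ true → t ≡ v) → (u ∈ tails p → W u ≡ true) → parity p ≡ F u xor F v →
    Σ[ F′ ∈ (Vertex G → Bool) ] (∀ t → t ∉ tails p ⊎ W t ≡ true → F′ t ≡ F t) × (∀ {e} → e ∈ edges p → Proper F′ e)
  colourAlong W F nil un v∈ inner u-ok par = F , (λ _ _ → refl) , λ ()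
  colourAlong {u} {v} W F (cons {w = y} e j p) un v∈ inner u-ok par with y ≟ v
  -- Once the end is reached the remaining walk is empty, and `par` says precisely that this edge is
  -- proper.
  ... | yes refl with closedPath-nil p (Unique[x∷xs]⇒x∉xs un)
  ...   | refl = F , (λ _ _ → refl) , λ { (here refl) → trans (joins-xor F j) (sym par) }
  colourAlong {u} {v} W F (cons {w = y} e j p) un v∈ inner u-ok par | no y≢v =
    F₂ , agree , λ { (here refl) → head ; (there e∈) → proper₂ e∈ }
    where
    y∉p = Unique[x∷xs]⇒x∉xs un
    F₁ : Vertex G → Bool
    F₁ t = if does (t ≟ y) then not (F u) else F t
    F₁-y : F₁ y ≡ not (F u)
    F₁-y = cong (if_then not (F u) else F y) (dec-true (y ≟ y) refl)
    F₁-≢ : ∀ {t} → t ≢ y → F₁ t ≡ F t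
    F₁-≢ {t} t≢y = cong (if_then not (F u) else F t) (dec-false (t ≟ y) t≢y)
    par₁ : parity p ≡ F₁ y xor F₁ v
    par₁ = trans (trans (sym (not-involutive (parity p))) (trans (cong not par) (not-distribˡ-xor (F u) (F v))))
                 (sym (cong₂ _xor_ F₁-y (F₁-≢ (y≢v ∘ sym))))
    rest = colourAlong W F₁ p (unique-tail un) v∈ (inner ∘ there) (⊥-elim ∘ y∉p) par₁
    F₂ = proj₁ rest
    agree₂ = proj₁ (proj₂ rest)
    proper₂ = proj₂ (proj₂ rest)
    W⇒≢y : ∀ {t} → W t ≡ true → t ≢ y
    W⇒≢y Wt refl = y≢v (inner (here refl) Wt)
    agree : ∀ t → t ∉ tails (cons e j p) ⊎ W t ≡ true → F₂ t ≡ F t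
    agree t (inj₁ t∉) = trans (agree₂ t (inj₁ (t∉ ∘ there))) (F₁-≢ (λ { refl → t∉ (here refl) }))
    agree t (inj₂ Wt) = trans (agree₂ t (inj₂ Wt)) (F₁-≢ (W⇒≢y Wt))
    u-agree : F₂ u ≡ F u
    u-agree with u ∈? tails (cons e j p)
    ... | yes u∈ = agree u (inj₂ (u-ok u∈))
    ... | no  u∉ = agree u (inj₁ u∉)
    head : Proper F₂ e
    head = trans (joins-xor F₂ j) (trans (cong₂ _xor_ u-agree (trans (agree₂ y (inj₁ y∉p)) F₁-y)) (flip (F u)))
      where
      flip : ∀ c → c xor not c ≡ true
      flip false = refl
      flip true  = refl

  -- Finding ears in a 2-connected graph

  TInside : (Vertex G → Bool) → Set
  TInside W = ∀ e → T e ≡ true → W (src G e) ≡ true × W (tgt G e) ≡ true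

  edge-off : ∀ {e} → TInside W → Joins G e u v → W u ≡ false → T e ≡ false
  edge-off {W} {e = e} T⊆W j u∉ with T e in eq
  ... | false = refl
  ... | true with T⊆W e eq | j
  ...   | s∈ , _  | inj₁ (refl , refl) = ⊥-elim (true≢false (trans (sym s∈) u∉))
  ...   | _  , t∈ | inj₂ (refl , refl) = ⊥-elim (true≢false (trans (sym t∈) u∉))

  crossing : ReachAvoid G x u v → W u ≡ true → W v ≡ false →
    ∃₂ λ s t → ∃[ e ] Joins G e s t × W s ≡ true × W t ≡ false
  crossing here u∈ v∉ = ⊥-elim (true≢false (trans (sym u∈) v∉))
  crossing {W = W} (step {u} {w} e j _ r) u∈ v∉ with W w in eq
  ... | true  = crossing r eq v∉
  ... | false = u , w , e , j , u∈ , eq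

  -- A path that stops at its first vertex of `W` and misses `x`. Preceded by an edge from a vertex
  -- `x` of `W` to a vertex outside `W`, it becomes an ear.
  record PathTo (W : Vertex G → Bool) (x u v : Vertex G) : Set where
    field
      walk   : Walk u v
      target : W v ≡ true
      path   : Unique (vertices walk)
      avoids : x ∉ vertices walk
      first  : ∀ {t} → t ∈ vertices walk → W t ≡ true → t ≡ v
      off    : ∀ {e} → e ∈ edges walk → T e ≡ false

  suffix : ∀ {W x u v t} (R : PathTo W x u v) → t ∈ vertices (PathTo.walk R) → PathTo W x t v
  suffix {u = u} R t∈ with split (PathTo.walk R) t∈
  ... | p₁ , p₂ , eq = record
    { walk   = p₂
    ; target = target
    ; path   = proj₁ (proj₂ (path-++⁻ p₁ p₂ (subst (Unique ∘ vertices) eq path)))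
    ; avoids = avoids ∘ grow
    ; first  = first ∘ grow
    ; off    = λ {e} e∈ → off (subst (e ∈_) (sym (trans (cong edges eq) (edges-++ p₁ p₂))) (∈-++⁺ʳ (edges p₁) e∈))
    }
    where
    open PathTo R hiding (walk)
    grow : ∀ {y} → y ∈ vertices p₂ → y ∈ vertices (PathTo.walk R)
    grow (here refl) = t∈
    grow {y} (there y∈) = there (subst (y ∈_) (sym (trans (cong tails eq) (tails-++ p₁ p₂))) (∈-++⁺ʳ (tails p₁) y∈))

  trivialPath : u ≢ x → W u ≡ true → PathTo W x u u
  trivialPath u≢x u∈ = record
    { walk = nil ; target = u∈ ; path = [] ∷ [] ; avoids = λ { (here x≡u) → u≢x (sym x≡u) }
    ; first = λ { (here t≡u) _ → t≡u } ; off = λ () }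

  -- The route is followed until it meets `W`; whenever the current vertex occurs again later,
  -- `suffix` cuts out the loop.
  pathTo : TInside W → ReachAvoid G x u v → u ≢ x → W v ≡ true → ∃[ t ] PathTo W x u t
  pathTo T⊆W here u≢x v∈ = _ , trivialPath u≢x v∈
  pathTo {W} {x} T⊆W (step {u} {w} e j w≢x r) u≢x v∈ with W u in Wu
  ... | true  = u , trivialPath u≢x Wu
  ... | false with pathTo T⊆W r w≢x v∈
  ...   | t , R with u ∈? vertices (PathTo.walk R)
  ...     | yes u∈ = t , suffix R u∈
  ...     | no  u∉ = t , record
    { walk   = cons e j (PathTo.walk R)
    ; target = target
    ; path   = unique-∷ u∉ path
    ; avoids = λ { (here x≡u) → u≢x (sym x≡u) ; (there x∈) → avoids x∈ }
    ; first  = λ { (here refl) Wt → ⊥-elim (true≢false (trans (sym Wt) Wu)) ; (there t∈) → first t∈ }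
    ; off    = λ { (here refl) → edge-off T⊆W j Wu ; (there e∈) → off e∈ }
    }
    where open PathTo R

  module _ (connected : ∀ x u v → u ≢ x → v ≢ x → ReachAvoid G x u v) where

    -- Some edge leads from `s` in `W` to `t` outside. Since G - s is connected, `t` can be joined
    -- to a second vertex of `W` without `s`, which closes an ear having `t` in its interior.
    properEar : TInside W → W a ≡ true → W b ≡ true → a ≢ b → W x ≡ false →
      ∃₂ λ u v → Σ[ E ∈ Ear W u v ] ∃[ t ] t ∈ tails (walk E) × W t ≡ false
    properEar {W} {a} {b} {x} T⊆W a∈ b∈ a≢b x∉
      -- Deleting `b` merely serves to obtain a walk from `a` to `x`.
      with crossing (connected b a x a≢b (λ { refl → true≢false (trans (sym b∈) x∉) })) a∈ x∉
    ... | s , t , e , j , s∈ , t∉ = build other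
      where
      t≢s : t ≢ s
      t≢s refl = true≢false (trans (sym s∈) t∉)
      other : ∃[ y ] y ≢ s × W y ≡ true
      other with a ≟ s
      ... | no  a≢s  = a , a≢s , a∈
      ... | yes refl = b , a≢b ∘ sym , b∈
      build : (∃[ y ] y ≢ s × W y ≡ true) → _
      build (y , y≢s , y∈) with pathTo T⊆W (connected s t y t≢s y≢s) t≢s y∈
      ... | v , R = s , v , record
        { walk   = cons e j (PathTo.walk R)
        ; start∈ = s∈
        ; end∈   = target
        ; unique = unique-∷ avoids path
        ; inner∉ = first
        ; edges∉ = λ { (here refl) → edge-off T⊆W (joins-sym j) t∉ ; (there e∈) → off e∈ }
        ; u≢v    = λ { refl → avoids (end∈vertices (PathTo.walk R)) }
        } , t , here refl , t∉
        where open PathTo R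

    private
      -- `k` strictly bounds the number of vertices outside `W`. This number drops at each step
      -- because the added ear has an interior vertex.
      extend : ∀ k (W F : Vertex G → Bool) → count (not ∘ W) < k → TInside W →
        W a ≡ true → W b ≡ true → a ≢ b → BadEar W F ⊎ Extension W F
      extend (suc k) W F bound T⊆W a∈ b∈ a≢b with any? (λ x → W x ≟ᵇ false)
      ... | no full with any? (λ e → (T e ≟ᵇ false) ×-dec (¬? ((F (src G e) xor F (tgt G e)) ≟ᵇ true)))
      ...   | no good = inj₂ (F , (λ _ _ → refl) , λ e e∉ → decidable-stable (_ ≟ᵇ true) (λ improper → good (e , e∉ , improper)))
      -- When `W` is everything, a monochromatic edge outside `T` is an ear of length one: its
      -- parity is odd and its colour sum 0.
      ...   | yes (e , e∉ , improper) = inj₁ (src G e , tgt G e , record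
        { walk   = cons e (inj₁ (refl , refl)) nil
        ; start∈ = all∈ (src G e)
        ; end∈   = all∈ (tgt G e)
        ; unique = unique-∷ (λ { (here eq) → noLoop G e eq }) ([] ∷ [])
        ; inner∉ = λ { (here eq) _ → eq }
        ; edges∉ = λ { (here refl) → e∉ }
        ; u≢v    = noLoop G e
        } , improper ∘ sym)
        where
        all∈ : ∀ x → W x ≡ true
        all∈ x = ¬-not (λ x∉ → full (x , x∉))
      extend (suc k) W F bound T⊆W a∈ b∈ a≢b | yes (x , x∉) with properEar T⊆W a∈ b∈ a≢b x∉
      ... | u , v , E , t , t∈E , t∉ with parity (walk E) ≟ᵇ (F u xor F v)
      ...   | no  bad = inj₁ (u , v , E , bad)
      ...   | yes par = conclude (extend k W′ F₁ (<-≤-trans smaller (s≤s⁻¹ bound)) (λ e e∈ → let s∈ , t∈ = T⊆W e e∈ in W⊆W′ s∈ , W⊆W′ t∈) (W⊆W′ a∈) (W⊆W′ b∈) a≢b)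
        where
        coloured = colourAlong W F (walk E) (unique-tail (unique E)) (end∈ E) (inner∉ E) (λ _ → start∈ E) par
        F₁ = proj₁ coloured
        agree : ∀ y → W y ≡ true → F₁ y ≡ F y
        agree y y∈ = proj₁ (proj₂ coloured) y (inj₂ y∈)
        W′ : Vertex G → Bool
        W′ y = W y ∨ does (y ∈? vertices (walk E))
        W⊆W′ : ∀ {y} → W y ≡ true → W′ y ≡ true
        W⊆W′ {y} y∈ = cong (_∨ does (y ∈? vertices (walk E))) y∈
        E⊆W′ : ∀ {y} → y ∈ vertices (walk E) → W′ y ≡ true
        E⊆W′ {y} y∈ = trans (cong (W y ∨_) (dec-true (y ∈? vertices (walk E)) y∈)) (∨-zeroʳ (W y))
        W′⊆ : ∀ y → W′ y ≡ true → W y ≡ true ⊎ (W y ≡ false × y ∈ vertices (walk E))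
        W′⊆ y y∈′ with W y
        ... | true  = inj₁ refl
        ... | false = inj₂ (refl , decidable-stable (y ∈? vertices (walk E))
          λ y∉ → true≢false (trans (sym y∈′) (dec-false (y ∈? vertices (walk E)) y∉)))
        smaller : count (not ∘ W′) < count (not ∘ W)
        smaller = count-mono-< shrink t (cong not (E⊆W′ (there t∈E))) (cong not t∉)
          where
          shrink : ∀ y → not (W′ y) ≡ true → not (W y) ≡ true
          shrink y eq with W y
          ... | false = refl
        conclude : BadEar W′ F₁ ⊎ Extension W′ F₁ → BadEar W F ⊎ Extension W F
        -- Shrinking requires the colouring `F₁`, which is proper along `E`; on `W` it agrees with
        -- `F`, so the resulting ear is bad for `F` as well.
        conclude (inj₁ bad) = inj₁ (badEar-cong agree (Prolong.badEar-shrink {F = F₁} E (proj₂ (proj₂ coloured)) W⊆W′ E⊆W′ W′⊆ bad))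
        conclude (inj₂ (F₂ , agree₂ , proper₂)) = inj₂ (F₂ , (λ y y∈ → trans (agree₂ y (W⊆W′ y∈)) (agree y y∈)) , proper₂)

    badEarOrExtension : (W F : Vertex G → Bool) → TInside W → W a ≡ true → W b ≡ true → a ≢ b →
      BadEar W F ⊎ Extension W F
    badEarOrExtension W F = extend (suc (count (not ∘ W))) W F ≤-refl

-- Circuits

even≤2 : ∀ c → Even c → c ≤ 2 → c ≡ 0 ⊎ c ≡ 2
even≤2 zero                ev le = inj₁ refl
even≤2 (suc (suc zero))    ev le = inj₂ refl
even≤2 (suc (suc (suc c))) ev (s≤s (s≤s ()))

module Circuits (G : Graph) where

  open Walks G
  open LinearAlgebra G
  open DecMembership (_≟_ {n G}) using (_∈?_)

  private variable
    u v w t x : Vertex G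

  record Circuit : Set where
    field
      {base}         : Vertex G
      closed         : Walk base base
      uniqueVertices : Unique (tails closed)
      uniqueEdges    : Unique (edges closed)

    vector : EdgeSet G
    vector = edgeVector closed

  open Circuit

  data OddCircuit : EdgeSet G → Set where
    oddCircuit : (C : Circuit) → parity (closed C) ≡ true → OddCircuit (vector C)

  vertices⊆tails : ∀ {e} (p : Walk u u) → e ∈ edges p → x ∈ vertices p → x ∈ tails p
  vertices⊆tails (cons e j p) _ (here refl) = end∈vertices p
  vertices⊆tails p            _ (there x∈)  = x∈

  -- The closed walk is cut at `v` and its two pieces are exchanged, which only permutes the lists.
  rotate : (p : Walk u u) → v ∈ tails p →
    Σ[ q ∈ Walk v v ] tails q ↭ tails p × edges q ↭ edges p × (∀ e → edgeVector q e ≡ edgeVector p e)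
  rotate p v∈ with split p (there v∈)
  ... | p₁ , p₂ , refl =
    p₂ ++ʷ p₁ ,
    subst₂ _↭_ (sym (tails-++ p₂ p₁)) (sym (tails-++ p₁ p₂)) (++-comm (tails p₂) (tails p₁)) ,
    subst₂ _↭_ (sym (edges-++ p₂ p₁)) (sym (edges-++ p₁ p₂)) (++-comm (edges p₂) (edges p₁)) ,
    λ e → trans (edgeVector-++ p₂ p₁ e) (trans (xor-comm (edgeVector p₂ e) (edgeVector p₁ e)) (sym (edgeVector-++ p₁ p₂ e)))

  incident⇒end : ∀ e v → incident G e v ≡ true → src G e ≡ v ⊎ tgt G e ≡ v
  incident⇒end e v inc with src G e ≟ v | tgt G e ≟ v
  ... | yes s≡v | _       = inj₁ s≡v
  ... | no _    | yes t≡v = inj₂ t≡v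

  joins⇒incidentʳ : ∀ {e} → Joins G e u v → incident G e v ≡ true
  joins⇒incidentʳ {v = v} {e} (inj₁ (_ , t≡v)) = trans (cong (does (src G e ≟ v) ∨_) (dec-true (tgt G e ≟ v) t≡v)) (∨-zeroʳ _)
  joins⇒incidentʳ {v = v} {e} (inj₂ (s≡v , _)) = cong (_∨ does (tgt G e ≟ v)) (dec-true (src G e ≟ v) s≡v)

  incident∈vertices : ∀ {e} (p : Walk u v) → e ∈ edges p → incident G e x ≡ true → x ∈ vertices p
  incident∈vertices {x = x} {e} p e∈ inc with incident⇒end e x inc
  ... | inj₁ refl = proj₁ (ends∈vertices p e∈)
  ... | inj₂ refl = proj₂ (ends∈vertices p e∈)

  -- Any later edge at `u` would make the path revisit its start. The given edge `d` is a default
  -- for the empty path.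
  startEdge : Edge G → (p : Walk u v) → Unique (vertices p) →
    Σ[ f ∈ Edge G ] (∀ {e} → e ∈ edges p → incident G e u ≡ true → e ≡ f)
  startEdge d nil          un = d , λ ()
  startEdge d (cons f j p) un = f , λ
    { (here e≡f) _   → e≡f
    ; (there e∈) inc → ⊥-elim (Unique[x∷xs]⇒x∉xs un (incident∈vertices p e∈ inc)) }

  -- Seen from v, a circuit consists of an edge at v followed by a path back to v, so only the first
  -- and the last edge can be incident with v.
  circuit-degree≤2 : (C : Circuit) → ∀ v → deg G (vector C) v ≤ 2
  circuit-degree≤2 C v with v ∈? tails (closed C)
  ... | no v∉ = subst (_≤ 2) (sym (trans (count-cong isolated) (count-false (m G)))) z≤n
    where
    isolated : ∀ e → vector C e ∧ incident G e v ≡ false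
    isolated e = ¬-not (λ eq → let Ce , inc = ∧-true (vector C e) _ eq ; e∈ = ∈edges (closed C) Ce
                           in v∉ (vertices⊆tails (closed C) e∈ (incident∈vertices (closed C) e∈ inc)))
  ... | yes v∈ with rotate (closed C) v∈
  ...   | nil , tails↭ , _ with () ← ∈-resp-↭ (↭-sym tails↭) v∈
  ...   | cons f j p , tails↭ , _ , vector≗ with startEdge f (rev p) (path-rev p (unique-resp-↭ (↭-sym tails↭) (uniqueVertices C)))
  ...     | g , only-g = subst (deg G (vector C) v ≤_) (cong₂ _+_ (count-δ f) (count-δ g)) (count-cover cover)
    where
    cover : ∀ e → vector C e ∧ incident G e v ≡ true → does (f ≟ e) ≡ true ⊎ does (g ≟ e) ≡ true
    cover e eq with ∧-true (vector C e) _ eq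
    ... | Ce , inc with ∈edges (cons f j p) (trans (vector≗ e) Ce)
    ...   | here e≡f = inj₁ (dec-true (f ≟ e) (sym e≡f))
    ...   | there e∈ = inj₂ (dec-true (g ≟ e) (sym (only-g (∈-resp-↭ (↭-sym (edges-rev p)) e∈) inc)))

  walk-edges-connected : ∀ {S e} (j : Joins G e u w) (p : Walk w v) → (∀ {f} → f ∈ edges (cons e j p) → S f ≡ true) →
    ∀ {f} → f ∈ edges (cons e j p) → Star (AdjIn G S) e f
  walk-edges-connected j p            S⊇ (here refl) = ε
  walk-edges-connected {w = w} j (cons e′ j′ p) S⊇ (there f∈) =
    (S⊇ (here refl) , S⊇ (there (here refl)) , w , joins⇒incidentʳ j , joins⇒incidentʳ (joins-sym j′)) ◅
    walk-edges-connected j′ p (S⊇ ∘ there) f∈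

  circuit-connected : (C : Circuit) → ∀ e f → vector C e ≡ true → vector C f ≡ true → Star (AdjIn G (vector C)) e f
  circuit-connected record { closed = cons d j p ; uniqueEdges = un } e f Ce Cf =
    star-reverse (λ (Sa , Sb , x , a , b) → Sb , Sa , x , b , a) (from (∈edges (cons d j p) Ce)) ◅◅ from (∈edges (cons d j p) Cf)
    where
    from : ∀ {f} → f ∈ edges (cons d j p) → Star (AdjIn G (edgeVector (cons d j p))) d f
    from = walk-edges-connected j p (edgeVector-∈ (cons d j p) un)

  -- Odd parity gives an edge. Degrees are even because the walk is closed, and being at most 2 they
  -- are 0 or 2.
  oddCircuit-isCircuit : ∀ {S} → OddCircuit S → IsCircuit G S
  oddCircuit-isCircuit (oddCircuit C odd) =
    ⨁-true (vector C) (trans (⨁-edgeVector≡parity (closed C)) odd) ,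
    (λ v → even≤2 _ (closedWalk-isCycle (closed C) v) (circuit-degree≤2 C v)) ,
    circuit-connected C

  joins-other : ∀ {e} → Joins G e u w → Joins G e w x → x ≡ u
  joins-other {e = e} (inj₁ (refl , refl)) (inj₁ (s≡t , _)) = ⊥-elim (noLoop G e s≡t)
  joins-other (inj₁ (refl , refl)) (inj₂ (s≡x , _)) = sym s≡x
  joins-other (inj₂ (refl , refl)) (inj₁ (_ , t≡x)) = sym t≡x
  joins-other {e = e} (inj₂ (refl , refl)) (inj₂ (_ , t≡s)) = ⊥-elim (noLoop G e (sym t≡s))

  -- `e` is incident with the start `w` of the path, so it can only be the first edge of `p`; it
  -- leads straight to `u`, where `p` must end.
  backtrack : ∀ {e} → Joins G e u w → (p : Walk w u) → Unique (vertices p) → e ∈ edges p →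
    ∀ f → edgeVector p f ≡ does (e ≟ f)
  backtrack j (cons e j′ p) un (there e∈) f = ⊥-elim (Unique[x∷xs]⇒x∉xs un (joined∈vertices p e∈ (joins-sym j)))
  backtrack j (cons e j′ p) un (here refl) f with joins-other j j′
  ... | refl with closedPath-nil p (Unique[x∷xs]⇒x∉xs (unique-tail un))
  ...   | refl = xor-identityʳ (does (e ≟ f))

  -- Closed walks as sums of circuits

  module _ {P : EdgeSet G → Set}
    (circuits : (C : Circuit) → ∀ {x y} → x ∈ tails (closed C) → y ∈ tails (closed C) → x ≢ y → Generated P (vector C)) where

    -- Either `e` is already an edge of `p`, and the two copies cancel, or the closed walk is a
    -- circuit.
    closing-generated : ∀ {e} (j : Joins G e u w) (p : Walk w u) → Unique (vertices p) → Generated P (edgeVector (cons e j p))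
    closing-generated {u} {w} {e} j p un with e ∈ᵉ? edges p
      where open DecMembership (_≟_ {m G}) using () renaming (_∈?_ to _∈ᵉ?_)
    ... | yes e∈ = none (λ f → trans (cong (does (e ≟ f) xor_) (backtrack j p un e∈ f)) (xor-same (does (e ≟ f))))
    -- The ends of `e` provide the two distinct vertices of the circuit.
    ... | no  e∉ = circuits C (here refl) (end∈vertices p) (joins-≢ (joins-sym j))
      where
      C : Circuit
      C = record { closed = cons e j p ; uniqueVertices = un ; uniqueEdges = unique-∷ e∉ (path-edges-unique p un) }

    -- Prepending an edge to a path closes at most one loop, formed by the edge and the piece of the
    -- path up to `u`. That loop is dropped and its vector is added to the generated difference.
    erase-loops : (p : Walk u v) →
      Σ[ q ∈ Walk u v ] Unique (vertices q) × Generated P (λ f → edgeVector p f xor edgeVector q f)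
    erase-loops nil = nil , [] ∷ [] , none (λ _ → refl)
    erase-loops {u} (cons e j p) with erase-loops p
    ... | q , un , g with u ∈? vertices q
    ...   | no u∉ = cons e j q , unique-∷ u∉ un , generated-cong (λ f → sym (same (does (e ≟ f)) _ _)) g
      where
      same : ∀ d a b → (d xor a) xor (d xor b) ≡ a xor b
      same d a b = trans (xor-interchange d a d b) (cong (_xor (a xor b)) (xor-same d))
    ...   | yes u∈ with split q u∈
    ...     | q₁ , q₂ , refl with path-++⁻ q₁ q₂ un
    ...       | un₁ , un₂ , _ = q₂ , un₂ , generated-cong regroup (generated-xor g (closing-generated j q₁ un₁))
      where
      shuffle : ∀ d a b c → (a xor (b xor c)) xor (d xor b) ≡ (d xor a) xor c
      shuffle d a b c = begin
        (a xor (b xor c)) xor (d xor b) ≡⟨ xor-comm (a xor (b xor c)) (d xor b) ⟩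
        (d xor b) xor (a xor (b xor c)) ≡⟨ xor-interchange d b a (b xor c) ⟩
        (d xor a) xor (b xor (b xor c)) ≡⟨ cong ((d xor a) xor_) (xor-cancelˡ b c) ⟩
        (d xor a) xor c                 ∎
        where open ≡-Reasoning
      regroup : ∀ f → (edgeVector p f xor edgeVector (q₁ ++ʷ q₂) f) xor (does (e ≟ f) xor edgeVector q₁ f)
        ≡ (does (e ≟ f) xor edgeVector p f) xor edgeVector q₂ f
      regroup f = trans (cong (λ b → (edgeVector p f xor b) xor (does (e ≟ f) xor edgeVector q₁ f)) (edgeVector-++ q₁ q₂ f))
        (shuffle (does (e ≟ f)) (edgeVector p f) (edgeVector q₁ f) (edgeVector q₂ f))

    -- Erasing all loops of a closed walk leaves the empty walk.
    closedWalk-generated : (p : Walk u u) → Generated P (edgeVector p)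
    closedWalk-generated p with erase-loops p
    ... | q , un , g with closedPath-nil q (Unique[x∷xs]⇒x∉xs un)
    ...   | refl = generated-cong (λ f → xor-identityʳ (edgeVector p f)) g

  module Fundamental {r : Vertex G} (walkTo : ∀ v → Walk r v) where

    -- A fundamental cycle in which arbitrary walks from the root replace the paths of a spanning
    -- tree.
    loop : (e : Edge G) → Walk r r
    loop e = walkTo (src G e) ++ʷ cons e (inj₁ (refl , refl)) (rev (walkTo (tgt G e)))

    -- Summing the loops of the edges of a cycle S, the walk to v occurs deg S v times and cancels.
    loops-span : ∀ S → IsCycle G S → ∀ f → lincomb G (edgeVector ∘ loop) S f ≡ S f
    loops-span S cyc f = begin
      lincomb G (edgeVector ∘ loop) S f
        ≡⟨ lincomb-⨁ (edgeVector ∘ loop) S f ⟩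
      ⨁ (λ e → S e ∧ edgeVector (loop e) f)
        ≡⟨ ⨁-cong (λ e → trans (cong (S e ∧_) (loop-vector e)) (∧-distribˡ-xor (S e) (does (e ≟ f)) _)) ⟩
      ⨁ (λ e → (S e ∧ does (e ≟ f)) xor (S e ∧ (φ (src G e) xor φ (tgt G e))))
        ≡⟨ ⨁-xor (λ e → S e ∧ does (e ≟ f)) (λ e → S e ∧ (φ (src G e) xor φ (tgt G e))) ⟩
      ⨁ (λ e → S e ∧ does (e ≟ f)) xor ⨁ (λ e → S e ∧ (φ (src G e) xor φ (tgt G e)))
        ≡⟨ cong₂ _xor_ (trans (⨁-cong (λ e → trans (∧-comm (S e) _) (cong (_∧ S e) (≟-sym e f)))) (⨁-δ f S)) (cycle⊥cut S cyc φ) ⟩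
      S f xor false
        ≡⟨ xor-identityʳ (S f) ⟩
      S f ∎
      where
      open ≡-Reasoning
      φ : Vertex G → Bool
      φ v = edgeVector (walkTo v) f
      ≟-sym : (e f : Edge G) → does (e ≟ f) ≡ does (f ≟ e)
      ≟-sym e f with e ≟ f
      ... | yes refl = sym (dec-true (e ≟ e) refl)
      ... | no  e≢f  = sym (dec-false (f ≟ e) (e≢f ∘ sym))
      loop-vector : ∀ e → edgeVector (loop e) f ≡ does (e ≟ f) xor (φ (src G e) xor φ (tgt G e))
      loop-vector e = trans (edgeVector-++ (walkTo (src G e)) _ f)
        (trans (cong (λ b → φ (src G e) xor (does (e ≟ f) xor b)) (edgeVector-rev (walkTo (tgt G e)) f))
               (xor-left-comm (φ (src G e)) (does (e ≟ f)) (φ (tgt G e))))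

-- Thetas

-- Reduces the disjointness conditions on four paths to the six unordered pairs.
pairwise : {R : Fin 4 → Fin 4 → Set} → Symmetric R →
  R zero (suc zero) → R zero (suc (suc zero)) → R zero (suc (suc (suc zero))) →
  R (suc zero) (suc (suc zero)) → R (suc zero) (suc (suc (suc zero))) →
  R (suc (suc zero)) (suc (suc (suc zero))) → ∀ i j → i ≢ j → R i j
pairwise sy r₀₁ r₀₂ r₀₃ r₁₂ r₁₃ r₂₃ = λ where
  zero                   zero                   i≢i → ⊥-elim (i≢i refl)
  zero                   (suc zero)             _   → r₀₁
  zero                   (suc (suc zero))       _   → r₀₂
  zero                   (suc (suc (suc zero))) _   → r₀₃
  (suc zero)             zero                   _   → sy r₀₁
  (suc zero)             (suc zero)             i≢i → ⊥-elim (i≢i refl)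
  (suc zero)             (suc (suc zero))       _   → r₁₂
  (suc zero)             (suc (suc (suc zero))) _   → r₁₃
  (suc (suc zero))       zero                   _   → sy r₀₂
  (suc (suc zero))       (suc zero)             _   → sy r₁₂
  (suc (suc zero))       (suc (suc zero))       i≢i → ⊥-elim (i≢i refl)
  (suc (suc zero))       (suc (suc (suc zero))) _   → r₂₃
  (suc (suc (suc zero))) zero                   _   → sy r₀₃
  (suc (suc (suc zero))) (suc zero)             _   → sy r₁₃
  (suc (suc (suc zero))) (suc (suc zero))       _   → sy r₂₃
  (suc (suc (suc zero))) (suc (suc (suc zero))) i≢i → ⊥-elim (i≢i refl)

module Thetas (G : Graph) where

  open Walks G
  open LinearAlgebra G
  open Circuits G
  open Circuit
  open DecMembership (_≟_ {n G}) using (_∈?_)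

  private variable
    u v w t x : Vertex G

  -- Walks as indexed paths

  walkLength : Walk u v → ℕ
  walkLength nil          = 0
  walkLength (cons e j p) = suc (walkLength p)

  vertexAt : (p : Walk u v) → Fin (suc (walkLength p)) → Vertex G
  vertexAt {u} p           zero    = u
  vertexAt (cons e j p)    (suc i) = vertexAt p i

  edgeAt : (p : Walk u v) → Fin (walkLength p) → Edge G
  edgeAt (cons e j p) zero    = e
  edgeAt (cons e j p) (suc i) = edgeAt p i

  vertexAt∈ : (p : Walk u v) → ∀ i → vertexAt p i ∈ vertices p
  vertexAt∈ p            zero    = here refl
  vertexAt∈ (cons e j p) (suc i) = there (vertexAt∈ p i)

  edgeAt∈ : (p : Walk u v) → ∀ i → edgeAt p i ∈ edges p
  edgeAt∈ (cons e j p) zero    = here refl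
  edgeAt∈ (cons e j p) (suc i) = there (edgeAt∈ p i)

  vertexAt-injective : (p : Walk u v) → Unique (vertices p) → ∀ {i k} → vertexAt p i ≡ vertexAt p k → i ≡ k
  vertexAt-injective p            un {zero}  {zero}  eq = refl
  vertexAt-injective (cons e j p) un {zero}  {suc k} eq = ⊥-elim (Unique[x∷xs]⇒x∉xs un (subst (_∈ vertices p) (sym eq) (vertexAt∈ p k)))
  vertexAt-injective (cons e j p) un {suc i} {zero}  eq = ⊥-elim (Unique[x∷xs]⇒x∉xs un (subst (_∈ vertices p) eq (vertexAt∈ p i)))
  vertexAt-injective (cons e j p) un {suc i} {suc k} eq = cong suc (vertexAt-injective p (unique-tail un) eq)

  edgeAt-injective : (p : Walk u v) → Unique (edges p) → ∀ {i k} → edgeAt p i ≡ edgeAt p k → i ≡ k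
  edgeAt-injective (cons e j p) un {zero}  {zero}  eq = refl
  edgeAt-injective (cons e j p) un {zero}  {suc k} eq = ⊥-elim (Unique[x∷xs]⇒x∉xs un (subst (_∈ edges p) (sym eq) (edgeAt∈ p k)))
  edgeAt-injective (cons e j p) un {suc i} {zero}  eq = ⊥-elim (Unique[x∷xs]⇒x∉xs un (subst (_∈ edges p) eq (edgeAt∈ p i)))
  edgeAt-injective (cons e j p) un {suc i} {suc k} eq = cong suc (edgeAt-injective p (unique-tail un) eq)

  edgeAt-joins : (p : Walk u v) → ∀ i → Joins G (edgeAt p i) (vertexAt p (inject₁ i)) (vertexAt p (suc i))
  edgeAt-joins (cons e j p) zero    = j
  edgeAt-joins (cons e j p) (suc i) = edgeAt-joins p i

  vertexAt-end : (p : Walk u v) → vertexAt p (fromℕ (walkLength p)) ≡ v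
  vertexAt-end nil          = refl
  vertexAt-end (cons e j p) = vertexAt-end p

  walkLength-%2 : (p : Walk u v) → walkLength p % 2 ≡ (if parity p then 1 else 0)
  walkLength-%2 nil          = refl
  walkLength-%2 (cons e j p) = %2-suc (walkLength p) (parity p) (walkLength-%2 p)

  walkLength-odd : (p : Walk u v) → parity p ≡ true → Odd (walkLength p)
  walkLength-odd p par = trans (walkLength-%2 p) (cong (if_then 1 else 0) par)

  gpath : (p : Walk u v) → Unique (vertices p) → GPath G
  gpath p un = record
    { len     = walkLength p
    ; vert    = vertexAt p
    ; edge    = edgeAt p
    ; vertInj = vertexAt-injective p un
    ; edgeInj = edgeAt-injective p (path-edges-unique p un)
    ; joins   = edgeAt-joins p
    }

  gpath-inner : (p : Walk u v) (un : Unique (vertices p)) → Inner (gpath p un) x → x ∈ vertices p × x ≢ u × x ≢ v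
  gpath-inner p un (i , refl , i≢0 , i≢len) =
    vertexAt∈ p i ,
    (λ eq → i≢0 (cong toℕ (vertexAt-injective p un {i} {zero} eq))) ,
    (λ eq → i≢len (trans (cong toℕ (vertexAt-injective p un (trans eq (sym (vertexAt-end p))))) (toℕ-fromℕ (walkLength p))))

  gpath-uses : ∀ {e} (p : Walk u v) (un : Unique (vertices p)) → UsesEdge (gpath p un) e → e ∈ edges p
  gpath-uses p un (i , refl) = edgeAt∈ p i

  MeetInEnds : Walk u v → Walk w t → Set
  MeetInEnds {u} {v} p q = ∀ {x} → x ∈ vertices p → x ∈ vertices q → x ≡ u ⊎ x ≡ v

  -- The even path is cut after its first edge: this edge is the path from b to c, and the rest, of
  -- odd length, is the path from c to a.
  theta⇒oddC3+ : u ≢ v → (p a : Walk u v) (q : Walk v u) →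
    Unique (vertices p) → Unique (vertices a) → Unique (vertices q) →
    parity p ≡ true → parity a ≡ true → parity q ≡ false →
    MeetInEnds p a → MeetInEnds p q → MeetInEnds a q →
    Disjoint (edges p) (edges a) → Disjoint (edges p) (edges q) → Disjoint (edges a) (edges q) →
    OddC3+ G
  theta⇒oddC3+ u≢v p a nil _ _ _ _ _ _ _ _ _ _ _ _ = ⊥-elim (u≢v refl)
  theta⇒oddC3+ {u} {v} u≢v p a (cons {w = w} e j q) up ua uq odd-p odd-a even-q pa pq aq e-pa e-pq e-aq = record
    { a = u ; b = v ; c = w
    ; ab = u≢v ; bc = joins-≢ j ; ca = w≢u
    ; path = route
    ; ends = λ { zero → cong (u ,_) (vertexAt-end p) ; (suc zero) → cong (u ,_) (vertexAt-end a)
               ; (suc (suc zero)) → refl ; (suc (suc (suc zero))) → cong (w ,_) (vertexAt-end q) }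
    ; oddLen = λ { zero → walkLength-odd p odd-p ; (suc zero) → walkLength-odd a odd-a
                 ; (suc (suc zero)) → refl ; (suc (suc (suc zero))) → walkLength-odd q odd-q }
    ; innerAvoid = avoid
    ; innerDisj = λ i k i≢k x x∈i x∈k → disjointInner i k i≢k (inner i x∈i) (inner k x∈k)
    ; edgeDisj = λ i k i≢k f f∈i f∈k → disjointEdges i k i≢k (uses i f∈i) (uses k f∈k)
    }
    where
    odd-q : parity q ≡ true
    odd-q = trans (sym (not-involutive (parity q))) (cong not even-q)
    -- Otherwise the rest of the even path would be empty, although its length is odd.
    w≢u : w ≢ u
    w≢u refl with closedPath-nil q (Unique[x∷xs]⇒x∉xs (unique-tail uq))
    ... | refl with () ← odd-q
    s : Walk v w
    s = cons e j nil
    us : Unique (vertices s)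
    us = unique-∷ (λ { (here v≡w) → joins-≢ j v≡w }) ([] ∷ [])
    route : Fin 4 → GPath G
    route zero                   = gpath p up
    route (suc zero)             = gpath a ua
    route (suc (suc zero))       = gpath s us
    route (suc (suc (suc zero))) = gpath q (unique-tail uq)
    InnerOf : Fin 4 → Vertex G → Set
    InnerOf zero                   x = x ∈ vertices p × x ≢ u × x ≢ v
    InnerOf (suc zero)             x = x ∈ vertices a × x ≢ u × x ≢ v
    InnerOf (suc (suc zero))       x = ⊥
    InnerOf (suc (suc (suc zero))) x = x ∈ vertices q × x ≢ w × x ≢ u
    inner : ∀ i {x} → Inner (route i) x → InnerOf i x
    inner zero                   = gpath-inner p up
    inner (suc zero)             = gpath-inner a ua
    inner (suc (suc (suc zero))) = gpath-inner q (unique-tail uq)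
    inner (suc (suc zero)) x∈ with gpath-inner s us x∈
    ... | here x≡v , x≢v , _           = x≢v x≡v
    ... | there (here x≡w) , _ , x≢w   = x≢w x≡w
    EdgeOf : Fin 4 → Edge G → Set
    EdgeOf zero                   f = f ∈ edges p
    EdgeOf (suc zero)             f = f ∈ edges a
    EdgeOf (suc (suc zero))       f = f ≡ e
    EdgeOf (suc (suc (suc zero))) f = f ∈ edges q
    uses : ∀ i {f} → UsesEdge (route i) f → EdgeOf i f
    uses zero                   = gpath-uses p up
    uses (suc zero)             = gpath-uses a ua
    uses (suc (suc (suc zero))) = gpath-uses q (unique-tail uq)
    uses (suc (suc zero)) f∈ with gpath-uses s us f∈
    ... | here f≡e = f≡e
    neither : ∀ {x} → x ≡ u ⊎ x ≡ v → x ≢ u → x ≢ v → ⊥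
    neither (inj₁ x≡u) x≢u _ = x≢u x≡u
    neither (inj₂ x≡v) _ x≢v = x≢v x≡v
    avoid : ∀ i x → Inner (route i) x → x ≢ u × x ≢ v × x ≢ w
    avoid i x x∈ = go i (inner i x∈)
      where
      go : ∀ i → InnerOf i x → x ≢ u × x ≢ v × x ≢ w
      go zero       (x∈ , x≢u , x≢v) = x≢u , x≢v , λ { refl → neither (pq x∈ (there (here refl))) x≢u x≢v }
      go (suc zero) (x∈ , x≢u , x≢v) = x≢u , x≢v , λ { refl → neither (aq x∈ (there (here refl))) x≢u x≢v }
      go (suc (suc (suc zero))) (x∈ , x≢w , x≢u) = x≢u , (λ { refl → Unique[x∷xs]⇒x∉xs uq x∈ }) , x≢w
    disjointInner : ∀ i k → i ≢ k → ∀ {x} → InnerOf i x → ¬ InnerOf k x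
    disjointInner = pairwise {R = λ i k → ∀ {x} → InnerOf i x → ¬ InnerOf k x} (λ r x∈k x∈i → r x∈i x∈k)
      (λ (x∈p , x≢u , x≢v) (x∈a , _) → neither (pa x∈p x∈a) x≢u x≢v)
      (λ _ ())
      (λ (x∈p , x≢u , x≢v) (x∈q , _) → neither (pq x∈p (there x∈q)) x≢u x≢v)
      (λ _ ())
      (λ (x∈a , x≢u , x≢v) (x∈q , _) → neither (aq x∈a (there x∈q)) x≢u x≢v)
      (λ ())
    disjointEdges : ∀ i k → i ≢ k → ∀ {f} → EdgeOf i f → ¬ EdgeOf k f
    disjointEdges = pairwise {R = λ i k → ∀ {f} → EdgeOf i f → ¬ EdgeOf k f} (λ r f∈k f∈i → r f∈i f∈k)
      (λ f∈p f∈a → e-pa (f∈p , f∈a))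
      (λ { f∈p refl → e-pq (f∈p , here refl) })
      (λ f∈p f∈q → e-pq (f∈p , there f∈q))
      (λ { f∈a refl → e-aq (f∈a , here refl) })
      (λ f∈a f∈q → e-aq (f∈a , there f∈q))
      (λ { refl f∈q → Unique[x∷xs]⇒x∉xs (path-edges-unique (cons e j q) uq) f∈q })

  -- Arcs and ears of a circuit

  record Arcs (C : Circuit) (u v : Vertex G) : Set where
    field
      there-arc        : Walk u v
      back-arc         : Walk v u
      path₁            : Unique (vertices there-arc)
      path₂            : Unique (vertices back-arc)
      tails-disjoint   : Disjoint (tails there-arc) (tails back-arc)
      edges-disjoint   : Disjoint (edges there-arc) (edges back-arc)
      vertices₁⊆       : ∀ {x} → x ∈ vertices there-arc → x ∈ tails (closed C)
      vertices₂⊆       : ∀ {x} → x ∈ vertices back-arc → x ∈ tails (closed C)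
      edges₁⊆          : ∀ {e} → e ∈ edges there-arc → e ∈ edges (closed C)
      edges₂⊆          : ∀ {e} → e ∈ edges back-arc → e ∈ edges (closed C)
      vectors          : ∀ e → edgeVector there-arc e xor edgeVector back-arc e ≡ vector C e

  -- The base is rotated to `u` and the walk split at `v`. Each tail list contains the end of its
  -- own arc, so disjointness of the tails also shows that both arcs are paths.
  arcs : (C : Circuit) → u ∈ tails (closed C) → v ∈ tails (closed C) → u ≢ v → Arcs C u v
  arcs {u} {v} C u∈ v∈ u≢v with rotate (closed C) u∈
  ... | q , tails↭ , edges↭ , vector≗ with split q (there (∈-resp-↭ (↭-sym tails↭) v∈))
  ... | a , b , refl = record
    { there-arc      = a
    ; back-arc       = b
    ; path₁          = unique-∷ (λ u∈a → disjoint (u∈a , u∈b)) unique-a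
    ; path₂          = unique-∷ (λ v∈b → disjoint (v∈a , v∈b)) unique-b
    ; tails-disjoint = disjoint
    ; edges-disjoint = proj₂ (proj₂ (unique-++⁻ (edges a) (subst Unique (edges-++ a b) (unique-resp-↭ (↭-sym edges↭) (uniqueEdges C)))))
    ; vertices₁⊆     = λ { (here refl) → u∈ ; (there x∈) → inTails (∈-++⁺ˡ x∈) }
    ; vertices₂⊆     = λ { (here refl) → v∈ ; (there x∈) → inTails (∈-++⁺ʳ (tails a) x∈) }
    ; edges₁⊆        = inEdges ∘ ∈-++⁺ˡ
    ; edges₂⊆        = inEdges ∘ ∈-++⁺ʳ (edges a)
    ; vectors        = λ e → trans (sym (edgeVector-++ a b e)) (vector≗ e)
    }
    where
    pieces = unique-++⁻ (tails a) (subst Unique (tails-++ a b) (unique-resp-↭ (↭-sym tails↭) (uniqueVertices C)))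
    unique-a = proj₁ pieces
    unique-b = proj₁ (proj₂ pieces)
    disjoint = proj₂ (proj₂ pieces)
    v∈a : v ∈ tails a
    v∈a = end∈tails u≢v a
    u∈b : u ∈ tails b
    u∈b = end∈tails (u≢v ∘ sym) b
    inTails : ∀ {x} → x ∈ tails a ++ tails b → x ∈ tails (closed C)
    inTails {x} = ∈-resp-↭ tails↭ ∘ subst (x ∈_) (sym (tails-++ a b))
    inEdges : ∀ {e} → e ∈ edges a ++ edges b → e ∈ edges (closed C)
    inEdges {e} = ∈-resp-↭ edges↭ ∘ subst (e ∈_) (sym (edges-++ a b))

  -- The arcs concatenate to a rotation of `closed C` only, so parities are compared through the
  -- edge vectors.
  arcs-parity : ∀ {C} (A : Arcs C u v) → parity (Arcs.there-arc A) xor parity (Arcs.back-arc A) ≡ parity (closed C)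
  arcs-parity {C = C} A = begin
    parity there-arc xor parity back-arc                   ≡⟨ sym (cong₂ _xor_ (⨁-edgeVector≡parity there-arc) (⨁-edgeVector≡parity back-arc)) ⟩
    ⨁ (edgeVector there-arc) xor ⨁ (edgeVector back-arc)   ≡⟨ sym (⨁-xor (edgeVector there-arc) (edgeVector back-arc)) ⟩
    ⨁ (λ e → edgeVector there-arc e xor edgeVector back-arc e) ≡⟨ ⨁-cong vectors ⟩
    ⨁ (vector C)                                           ≡⟨ ⨁-edgeVector≡parity (closed C) ⟩
    parity (closed C)                                      ∎
    where
    open Arcs A
    open ≡-Reasoning

  oddClosed-vertices : (p : Walk u u) → parity p ≡ true → ∃₂ λ x y → x ∈ tails p × y ∈ tails p × x ≢ y
  oddClosed-vertices {u} (cons {w = w} e j p) odd = w , u , here refl , end∈vertices p , joins-≢ (joins-sym j)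

  module CircuitEars (C : Circuit) where

    open Ears G (vector C)
    open Ear

    inCircuit : Vertex G → Bool
    inCircuit x = does (x ∈? tails (closed C))

    inCircuit⁺ : x ∈ tails (closed C) → inCircuit x ≡ true
    inCircuit⁺ {x} = dec-true (x ∈? tails (closed C))

    inCircuit⁻ : inCircuit x ≡ true → x ∈ tails (closed C)
    inCircuit⁻ {x} eq with yes x∈ ← x ∈? tails (closed C) = x∈

    circuitEdgesInside : TInside inCircuit
    circuitEdgesInside e Ce = inCircuit⁺ (on (proj₁ ends)) , inCircuit⁺ (on (proj₂ ends))
      where
      e∈ = ∈edges (closed C) Ce
      ends = ends∈vertices (closed C) e∈
      on : x ∈ vertices (closed C) → x ∈ tails (closed C)
      on = vertices⊆tails (closed C) e∈

    reverseEar : Ear inCircuit u v → Ear inCircuit v u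
    reverseEar {u} E = record
      { walk   = rev (walk E)
      ; start∈ = end∈ E
      ; end∈   = start∈ E
      ; unique = unique-rev
      ; inner∉ = λ {t} t∈ Wt → back t∈ (∈-resp-↭ (vertices-rev (walk E)) (there t∈)) Wt
      ; edges∉ = edges∉ E ∘ ∈-resp-↭ (edges-rev (walk E))
      ; u≢v    = u≢v E ∘ sym
      }
      where
      unique-rev = path-rev (walk E) (unique E)
      back : t ∈ tails (rev (walk E)) → t ∈ vertices (walk E) → inCircuit t ≡ true → t ≡ u
      back t∈ (here t≡u)  Wt = t≡u
      back t∈ (there t∈E) Wt with inner∉ E t∈E Wt
      ... | refl = ⊥-elim (Unique[x∷xs]⇒x∉xs unique-rev t∈)

    ear-arc-edges : (E : Ear inCircuit u v) {q : Walk w t} → (∀ {e} → e ∈ edges q → e ∈ edges (closed C)) →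
      Disjoint (edges (walk E)) (edges q)
    ear-arc-edges E q⊆ (e∈E , e∈q) =
      true≢false (trans (sym (edgeVector-∈ (closed C) (uniqueEdges C) (q⊆ e∈q))) (edges∉ E e∈E))

    -- An ear meets the circuit only in its ends, so it closes up with an arc to a new circuit.
    earCircuit : (E : Ear inCircuit u v) (q : Walk v u) → Unique (vertices q) →
      (∀ {x} → x ∈ vertices q → x ∈ tails (closed C)) → (∀ {e} → e ∈ edges q → e ∈ edges (closed C)) → Circuit
    earCircuit E q uq q⊆ q-edges⊆ = record
      { closed         = walk E ++ʷ q
      ; uniqueVertices = subst Unique (sym (tails-++ (walk E) q)) (unique-++⁺ (unique-tail (unique E)) (unique-tail uq) disjoint)
      ; uniqueEdges    = subst Unique (sym (edges-++ (walk E) q))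
          (unique-++⁺ (path-edges-unique (walk E) (unique E)) (path-edges-unique q uq) (ear-arc-edges E {q} q-edges⊆))
      }
      where
      disjoint : Disjoint (tails (walk E)) (tails q)
      disjoint (x∈E , x∈q) with inner∉ E x∈E (inCircuit⁺ (q⊆ (there x∈q)))
      ... | refl = Unique[x∷xs]⇒x∉xs uq x∈q

    ear-meets : (E : Ear inCircuit u v) {q : Walk w t} → (∀ {x} → x ∈ vertices q → x ∈ tails (closed C)) → MeetInEnds (walk E) q
    ear-meets E q⊆ (here x≡u)  x∈q = inj₁ x≡u
    ear-meets E q⊆ (there x∈E) x∈q = inj₂ (inner∉ E x∈E (inCircuit⁺ (q⊆ x∈q)))

    arcs-meet : (A : Arcs C u v) → MeetInEnds (Arcs.there-arc A) (Arcs.back-arc A)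
    arcs-meet A (here x≡u)  x∈₂         = inj₁ x≡u
    arcs-meet A (there x∈₁) (here x≡v)  = inj₂ x≡v
    arcs-meet A (there x∈₁) (there x∈₂) = ⊥-elim (Arcs.tails-disjoint A (x∈₁ , x∈₂))

    -- An odd circuit has one odd and one even arc between the ends of the ear.
    oddEar⇒oddC3+ : parity (closed C) ≡ true → (E : Ear inCircuit u v) → parity (walk E) ≡ true → OddC3+ G
    oddEar⇒oddC3+ {u} {v} odd-C E odd-E with arcs C (inCircuit⁻ (start∈ E)) (inCircuit⁻ (end∈ E)) (u≢v E)
    ... | A with parity (Arcs.there-arc A) in par₁ | parity (Arcs.back-arc A) in par₂
    ...   | true | false =
      theta⇒oddC3+ (u≢v E) (walk E) there-arc back-arc (unique E) path₁ path₂ odd-E par₁ par₂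
        (ear-meets E vertices₁⊆) (ear-meets E vertices₂⊆) (arcs-meet A)
        (ear-arc-edges E {there-arc} edges₁⊆) (ear-arc-edges E {back-arc} edges₂⊆) edges-disjoint
      where open Arcs A
    ...   | false | true =
      theta⇒oddC3+ (u≢v E) (walk E) (rev back-arc) (rev there-arc)
        (unique E) (path-rev back-arc path₂) (path-rev there-arc path₁)
        odd-E (trans (parity-rev back-arc) par₂) (trans (parity-rev there-arc) par₁)
        (λ x∈E x∈ → ear-meets E vertices₂⊆ x∈E (unrev₂ x∈)) (λ x∈E x∈ → ear-meets E vertices₁⊆ x∈E (unrev₁ x∈))
        (λ x∈₂ x∈₁ → arcs-meet A (unrev₁ x∈₁) (unrev₂ x∈₂))
        (ear-arc-edges E {rev back-arc} (edges₂⊆ ∘ ∈-resp-↭ (edges-rev back-arc)))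
        (ear-arc-edges E {rev there-arc} (edges₁⊆ ∘ ∈-resp-↭ (edges-rev there-arc)))
        (λ (e∈₂ , e∈₁) → edges-disjoint (∈-resp-↭ (edges-rev there-arc) e∈₁ , ∈-resp-↭ (edges-rev back-arc) e∈₂))
      where
      open Arcs A
      unrev₁ : x ∈ vertices (rev there-arc) → x ∈ vertices there-arc
      unrev₁ = ∈-resp-↭ (vertices-rev there-arc)
      unrev₂ : x ∈ vertices (rev back-arc) → x ∈ vertices back-arc
      unrev₂ = ∈-resp-↭ (vertices-rev back-arc)
    ...   | true | true = ⊥-elim (true≢false (trans (sym odd-C) (trans (sym (arcs-parity A)) (cong₂ _xor_ par₁ par₂))))
    ...   | false | false = ⊥-elim (true≢false (trans (sym odd-C) (trans (sym (arcs-parity A)) (cong₂ _xor_ par₁ par₂))))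

    module _ (connected : ∀ x u v → u ≢ x → v ≢ x → ReachAvoid G x u v) where

      -- A bad ear for the constant colouring is odd and is excluded. The extension is constant on
      -- the circuit and proper elsewhere, so its cut is the complement of the circuit; a cycle
      -- meets it evenly.
      oddCircuit-pairing : OddC3+Free G → parity (closed C) ≡ true → ∀ D → IsCycle G D → ⟨ vector C , D ⟩ ≡ ⨁ D
      oddCircuit-pairing free odd D D-cycle with oddClosed-vertices (closed C) odd
      ... | x , y , x∈ , y∈ , x≢y
          with badEarOrExtension connected inCircuit (λ _ → false) circuitEdgesInside (inCircuit⁺ x∈) (inCircuit⁺ y∈) x≢y
      ...   | inj₁ (_ , _ , E , bad) = ⊥-elim (free (oddEar⇒oddC3+ odd E (¬-not bad)))
      ...   | inj₂ (F , F≗ , F-proper) = xor-≡false ⟨ vector C , D ⟩ (⨁ D)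
        (trans (sym (⨁-xor (λ e → vector C e ∧ D e) D)) (trans (⨁-cong (λ e → sym (outside e))) (cycle⊥cut D D-cycle F)))
        where
        complement : ∀ c d → d ∧ not c ≡ (c ∧ d) xor d
        complement false d = ∧-identityʳ d
        complement true  d = trans (∧-zeroʳ d) (sym (xor-same d))
        cut : ∀ e → F (src G e) xor F (tgt G e) ≡ not (vector C e)
        cut e with vector C e in eq
        ... | false = F-proper e eq
        ... | true with circuitEdgesInside e eq
        ...   | s∈ , t∈ = cong₂ _xor_ (F≗ (src G e) s∈) (F≗ (tgt G e) t∈)
        outside : ∀ e → D e ∧ (F (src G e) xor F (tgt G e)) ≡ (vector C e ∧ D e) xor D e
        outside e = trans (cong (D e ∧_) (cut e)) (complement (vector C e) (D e))

      -- The closed walk is coloured with only its base prescribed; even parity matches the equal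
      -- colours at its two coinciding ends.
      alternating : parity (closed C) ≡ false → Σ[ F ∈ (Vertex G → Bool) ] (∀ {e} → e ∈ edges (closed C) → Proper F e)
      alternating even with colourAlong isBase (λ _ → false) (closed C) (uniqueVertices C) base-isBase
                              (λ {t} _ → isBase⁻ t) (λ _ → base-isBase) even
        where
        isBase : Vertex G → Bool
        isBase t = does (t ≟ base C)
        base-isBase : isBase (base C) ≡ true
        base-isBase = dec-true (base C ≟ base C) refl
        isBase⁻ : ∀ t → isBase t ≡ true → t ≡ base C
        isBase⁻ t eq with yes t≡base ← t ≟ base C = t≡base
      ... | F , _ , proper = F , proper

      -- An extension would be proper on every edge and make G bipartite. Otherwise both arcs have
      -- parity F s + F t and the bad ear the other one, so ear and arc form an odd circuit on
      -- either side; the ear cancels in their sum.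
      evenCircuit-generated : NonBipartite G → parity (closed C) ≡ false →
        x ∈ tails (closed C) → u ∈ tails (closed C) → x ≢ u → Generated OddCircuit (vector C)
      evenCircuit-generated nonBip even x∈ u∈ x≢u with alternating even
      ... | F , proper with badEarOrExtension connected inCircuit F circuitEdgesInside (inCircuit⁺ x∈) (inCircuit⁺ u∈) x≢u
      ...   | inj₂ (F′ , F′≗ , F′-proper) = ⊥-elim (nonBip (F′ , λ e same → true≢false
        (trans (sym (F′-everywhere e)) (trans (cong (F′ (src G e) xor_) (sym same)) (xor-same (F′ (src G e)))))))
        where
        F′-everywhere : ∀ e → Proper F′ e
        F′-everywhere e with vector C e in eq
        ... | false = F′-proper e eq
        ... | true with circuitEdgesInside e eq
        ...   | s∈ , t∈ = trans (cong₂ _xor_ (F′≗ (src G e) s∈) (F′≗ (tgt G e) t∈)) (proper (∈edges (closed C) eq))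
      ...   | inj₁ (s , t , E , bad) =
        add (oddCircuit C₁ odd₁) (add (oddCircuit C₂ odd₂) (none (λ _ → refl)) (λ _ → refl)) vectors′
        where
        open Arcs (arcs C (inCircuit⁻ (start∈ E)) (inCircuit⁻ (end∈ E)) (u≢v E))
        C₁ = earCircuit E back-arc path₂ vertices₂⊆ edges₂⊆
        C₂ = earCircuit (reverseEar E) there-arc path₁ vertices₁⊆ edges₁⊆
        opposite : ∀ a b → a ≢ b → a xor b ≡ true
        opposite a b a≢b = ¬-not (a≢b ∘ xor-≡false a b)
        par₁ : parity there-arc ≡ F s xor F t
        par₁ = proper-parity F there-arc (proper ∘ edges₁⊆)
        par₂ : parity back-arc ≡ F s xor F t
        par₂ = trans (proper-parity F back-arc (proper ∘ edges₂⊆)) (xor-comm (F t) (F s))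
        odd₁ : parity (walk E ++ʷ back-arc) ≡ true
        odd₁ = trans (parity-++ (walk E) back-arc) (opposite _ _ (λ eq → bad (trans eq par₂)))
        odd₂ : parity (rev (walk E) ++ʷ there-arc) ≡ true
        odd₂ = trans (parity-++ (rev (walk E)) there-arc)
          (opposite _ _ (λ eq → bad (trans (sym (parity-rev (walk E))) (trans eq par₁))))
        vectors′ : ∀ e → vector C₁ e xor (vector C₂ e xor false) ≡ vector C e
        vectors′ e = begin
          vector C₁ e xor (vector C₂ e xor false)
            ≡⟨ cong₂ _xor_ (edgeVector-++ (walk E) back-arc e) (trans (xor-identityʳ _) (edgeVector-++ (rev (walk E)) there-arc e)) ⟩
          (π xor β) xor (edgeVector (rev (walk E)) e xor α)
            ≡⟨ cong (λ z → (π xor β) xor (z xor α)) (edgeVector-rev (walk E) e) ⟩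
          (π xor β) xor (π xor α) ≡⟨ xor-interchange π β π α ⟩
          (π xor π) xor (β xor α) ≡⟨ cong₂ _xor_ (xor-same π) (xor-comm β α) ⟩
          α xor β                 ≡⟨ vectors e ⟩
          vector C e              ∎
          where
          open ≡-Reasoning
          α = edgeVector there-arc e
          β = edgeVector back-arc e
          π = edgeVector (walk E) e

-- The equivalences

some-vertex : ∀ {k} → 3 ≤ k → Fin k
some-vertex {suc k} _ = zero

-- Reachability is given only after deletion of a vertex, so joining two vertices takes a third one
-- to delete.
third : ∀ {k} → 3 ≤ k → (u v : Fin k) → ∃[ z ] u ≢ z × v ≢ z
third (s≤s (s≤s (s≤s _))) zero          zero          = suc zero , (λ ()) , λ ()
third (s≤s (s≤s (s≤s _))) zero          (suc zero)    = suc (suc zero) , (λ ()) , λ ()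
third (s≤s (s≤s (s≤s _))) zero          (suc (suc _)) = suc zero , (λ ()) , λ ()
third (s≤s (s≤s (s≤s _))) (suc zero)    zero          = suc (suc zero) , (λ ()) , λ ()
third (s≤s (s≤s (s≤s _))) (suc (suc _)) zero          = suc zero , (λ ()) , λ ()
third (s≤s (s≤s (s≤s _))) (suc _)       (suc _)       = zero , (λ ()) , λ ()

module _ (G : Graph) where

  open Walks G
  open LinearAlgebra G
  open Circuits G
  open Thetas G using (walkLength; walkLength-%2; module CircuitEars)

  steps : ∀ l (at : Fin (suc l) → Vertex G) (by : Fin l → Edge G) →
    (∀ i → Joins G (by i) (at (inject₁ i)) (at (suc i))) →
    Σ[ p ∈ Walk (at zero) (at (fromℕ l)) ] walkLength p ≡ l × (∀ {e} → e ∈ edges p → ∃[ i ] by i ≡ e)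
  steps zero    at by jn = nil , refl , λ ()
  steps (suc l) at by jn with steps l (at ∘ suc) (by ∘ suc) (jn ∘ suc)
  ... | p , length≡ , uses = cons (by zero) (jn zero) p , cong suc length≡ ,
    λ { (here refl) → zero , refl ; (there e∈) → let i , eq = uses e∈ in suc i , eq }

  -- The pair of ends is abstracted to `xy`, so that the walks start and end literally at branch
  -- vertices and can be concatenated.
  gpath-walk : (P : GPath G) → Odd (len P) → ∀ {xy} → (start P , end P) ≡ xy →
    Σ[ p ∈ Walk (proj₁ xy) (proj₂ xy) ] parity p ≡ true × (∀ {e} → e ∈ edges p → UsesEdge P e)
  gpath-walk P odd refl with steps (len P) (vert P) (edge P) (joins P)
  ... | p , length≡ , uses = p , odd⇒parity (parity p) (trans (sym (walkLength-%2 p)) (trans (cong (_% 2) length≡) odd)) , uses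
    where
    odd⇒parity : ∀ b → (if b then 1 else 0) ≡ 1 → b ≡ true
    odd⇒parity true _ = refl

  edgeDisjoint⇒orthogonal : ∀ {u v w t} (p : Walk u v) (q : Walk w t) → Disjoint (edges p) (edges q) →
    ⟨ edgeVector p , edgeVector q ⟩ ≡ false
  edgeDisjoint⇒orthogonal p q disj = trans (⨁-cong (λ e → ¬-not (λ both →
    let e∈p , e∈q = ∧-true (edgeVector p e) _ both in disj (∈edges p e∈p , ∈edges q e∈q)))) (⨁-false (m G))

  -- The two odd a-b paths, each closed by the even walk `q` through c, are odd cycles. By
  -- edge-disjointness their pairing is ⟨q,q⟩ = 0, whereas the product of their parities is 1.
  multiplicative⇒oddC3+Free : Multiplicative → OddC3+Free G
  multiplicative⇒oddC3+Free mult X = true≢false (trans (sym odd-odd) (trans (sym (mult Z₀ Z₁ cycle₀ cycle₁)) even))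
    where
    open OddC3+ X
    i₀ i₁ i₂ i₃ : Fin 4
    i₀ = zero
    i₁ = suc zero
    i₂ = suc (suc zero)
    i₃ = suc (suc (suc zero))
    route = λ i → gpath-walk (path i) (oddLen i) (ends i)
    p₀ = proj₁ (route i₀)
    p₁ = proj₁ (route i₁)
    p₂ = proj₁ (route i₂)
    p₃ = proj₁ (route i₃)
    q = p₂ ++ʷ p₃
    Z₀ = edgeVector (p₀ ++ʷ q)
    Z₁ = edgeVector (p₁ ++ʷ q)
    cycle₀ : IsCycle G Z₀
    cycle₀ = closedWalk-isCycle (p₀ ++ʷ q)
    cycle₁ : IsCycle G Z₁
    cycle₁ = closedWalk-isCycle (p₁ ++ʷ q)
    disjoint : ∀ i k → i ≢ k → Disjoint (edges (proj₁ (route i))) (edges (proj₁ (route k)))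
    disjoint i k i≢k (e∈i , e∈k) = edgeDisj i k i≢k _ (proj₂ (proj₂ (route i)) e∈i) (proj₂ (proj₂ (route k)) e∈k)
    disjoint-q : ∀ i → i ≢ i₂ → i ≢ i₃ → Disjoint (edges (proj₁ (route i))) (edges q)
    disjoint-q i i≢2 i≢3 {e} (e∈i , e∈q) with ∈-++⁻ (edges p₂) (subst (e ∈_) (edges-++ p₂ p₃) e∈q)
    ... | inj₁ e∈2 = disjoint i i₂ i≢2 (e∈i , e∈2)
    ... | inj₂ e∈3 = disjoint i i₃ i≢3 (e∈i , e∈3)
    parity-q : parity q ≡ false
    parity-q = trans (parity-++ p₂ p₃) (cong₂ _xor_ (proj₁ (proj₂ (route i₂))) (proj₁ (proj₂ (route i₃))))
    odd-Z : ∀ {u v} (p : Walk u v) (r : Walk v u) → parity p ≡ true → parity r ≡ false → ⨁ (edgeVector (p ++ʷ r)) ≡ true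
    odd-Z p r odd-p even-r = trans (⨁-edgeVector≡parity (p ++ʷ r)) (trans (parity-++ p r) (cong₂ _xor_ odd-p even-r))
    odd-odd : ⨁ Z₀ ∧ ⨁ Z₁ ≡ true
    odd-odd = cong₂ _∧_ (odd-Z p₀ q (proj₁ (proj₂ (route i₀))) parity-q) (odd-Z p₁ q (proj₁ (proj₂ (route i₁))) parity-q)
    pairing : ∀ {u v w t} (p : Walk u v) (r : Walk w t) {z} (r′ : Walk t z) →
      ⟨ edgeVector p , edgeVector (r ++ʷ r′) ⟩ ≡ ⟨ edgeVector p , edgeVector r ⟩ xor ⟨ edgeVector p , edgeVector r′ ⟩
    pairing p r r′ = trans (⨁-cong (λ e → trans (cong (edgeVector p e ∧_) (edgeVector-++ r r′ e)) (∧-distribˡ-xor (edgeVector p e) _ _)))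
      (⨁-xor (λ e → edgeVector p e ∧ edgeVector r e) (λ e → edgeVector p e ∧ edgeVector r′ e))
    even : ⟨ Z₀ , Z₁ ⟩ ≡ false
    even = begin
      ⟨ Z₀ , Z₁ ⟩                                           ≡⟨ ⟨⟩-comm Z₀ Z₁ ⟩
      ⟨ Z₁ , Z₀ ⟩                                           ≡⟨ pairing (p₁ ++ʷ q) p₀ q ⟩
      ⟨ Z₁ , edgeVector p₀ ⟩ xor ⟨ Z₁ , edgeVector q ⟩
        ≡⟨ cong₂ _xor_ (trans (⟨⟩-comm Z₁ (edgeVector p₀)) (pairing p₀ p₁ q)) (trans (⟨⟩-comm Z₁ (edgeVector q)) (pairing q p₁ q)) ⟩
      (⟨ edgeVector p₀ , edgeVector p₁ ⟩ xor ⟨ edgeVector p₀ , edgeVector q ⟩) xor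
      (⟨ edgeVector q , edgeVector p₁ ⟩ xor ⟨ edgeVector q , edgeVector q ⟩)
        ≡⟨ cong₂ _xor_
             (cong₂ _xor_ (edgeDisjoint⇒orthogonal p₀ p₁ (disjoint i₀ i₁ λ ())) (edgeDisjoint⇒orthogonal p₀ q (disjoint-q i₀ (λ ()) (λ ()))))
             (cong₂ _xor_ (trans (⟨⟩-comm (edgeVector q) (edgeVector p₁)) (edgeDisjoint⇒orthogonal p₁ q (disjoint-q i₁ (λ ()) (λ ()))))
                          (trans (⟨⟩-self (edgeVector q)) (trans (⨁-edgeVector≡parity q) parity-q))) ⟩
      false ∎
      where open ≡-Reasoning

  module _ (twoConnected : TwoConnected G) where

    private
      connected = proj₂ twoConnected

    reachAvoid⇒walk : ∀ {x u v} → ReachAvoid G x u v → Walk u v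
    reachAvoid⇒walk here           = nil
    reachAvoid⇒walk (step e j _ r) = cons e j (reachAvoid⇒walk r)

    walkBetween : ∀ u v → Walk u v
    walkBetween u v = let z , u≢z , v≢z = third (proj₁ twoConnected) u v in reachAvoid⇒walk (connected z u v u≢z v≢z)

    oddCircuit-isCycle : ∀ {S} → OddCircuit S → IsCycle G S
    oddCircuit-isCycle (oddCircuit C _) = closedWalk-isCycle (Circuit.closed C)

    oddCircuit-isOdd : ∀ {S} → OddCircuit S → OddSet G S
    oddCircuit-isOdd (oddCircuit C odd) = ⨁⇒odd (Circuit.vector C) (trans (⨁-edgeVector≡parity (Circuit.closed C)) odd)

    oddCircuit-pairing : OddC3+Free G → ∀ {S} → OddCircuit S → ∀ D → IsCycle G D → ⟨ S , D ⟩ ≡ ⨁ D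
    oddCircuit-pairing free (oddCircuit C odd) = CircuitEars.oddCircuit-pairing C connected free odd

    module _ (nonBipartite : NonBipartite G) where

      circuit-generated : (C : Circuit) → ∀ {x y} → x ∈ tails (Circuit.closed C) → y ∈ tails (Circuit.closed C) →
        x ≢ y → Generated OddCircuit (Circuit.vector C)
      circuit-generated C x∈ y∈ x≢y with parity (Circuit.closed C) in par
      ... | true  = add (oddCircuit C par) (none (λ _ → refl)) (λ e → xor-identityʳ (Circuit.vector C e))
      ... | false = CircuitEars.evenCircuit-generated C connected nonBipartite par x∈ y∈ x≢y

      open Fundamental (walkBetween (some-vertex (proj₁ twoConnected)))

      -- The loops at a root span the cycle space and are sums of circuits, each of which is a sum
      -- of odd circuits; independent ones are selected among these.
      oddCircuitBasis : Σ[ F ∈ IndependentFamily OddCircuit ] IsCircuitBasis G (IndependentFamily.member F)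
      oddCircuitBasis with absorbAll (edgeVector ∘ loop) (λ e → closedWalk-generated circuit-generated (loop e))
      ... | F , loops∈ = F , (((oddCircuit-isCycle ∘ satisfies) , independent , spans) , oddCircuit-isCircuit ∘ satisfies)
        where
        open IndependentFamily F
        spans : Spans G member
        spans S S-cycle = inSpan-cong (loops-span S S-cycle) (inSpan-lincomb (edgeVector ∘ loop) S loops∈)

      oddC3+Free⇒totallyOddCircuitBasis : OddC3+Free G → HasTotallyOddCircuitBasis G
      oddC3+Free⇒totallyOddCircuitBasis free with oddCircuitBasis
      ... | F , basis = size , member , basis , oddCircuit-isOdd ∘ satisfies , λ i j _ →
        ⨁⇒odd (λ e → member i e ∧ member j e) (trans
          (oddCircuit-pairing free (satisfies i) (member j) (oddCircuit-isCycle (satisfies j)))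
          (odd⇒⨁ (member j) (oddCircuit-isOdd (satisfies j))))
        where open IndependentFamily F

      -- The basis of odd circuits ensures that (iii) is not vacuous.
      everyOddBasis⇒totallyOddCircuitBasis : EveryOddCycleBasisTotallyOdd G → HasTotallyOddCircuitBasis G
      everyOddBasis⇒totallyOddCircuitBasis every with oddCircuitBasis
      ... | F , basis = size , member , basis , every size member (proj₁ basis) (oddCircuit-isOdd ∘ satisfies)
        where open IndependentFamily F

theorem2p2 : (G : Graph) → TwoConnected G → NonBipartite G →
    (OddC3+Free G ⇔ HasTotallyOddCircuitBasis G)
    × (HasTotallyOddCircuitBasis G ⇔ EveryOddCycleBasisTotallyOdd G)
theorem2p2 G twoConnected nonBipartite =
  mk⇔ (oddC3+Free⇒totallyOddCircuitBasis G twoConnected nonBipartite)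
      (multiplicative⇒oddC3+Free G ∘ multiplicative) ,
  mk⇔ (multiplicative⇒everyOddCycleBasisTotallyOdd ∘ multiplicative)
      (everyOddBasis⇒totallyOddCircuitBasis G twoConnected nonBipartite)
  where
  open LinearAlgebra G
  multiplicative : HasTotallyOddCircuitBasis G → Multiplicative
  multiplicative (_ , _ , (basis , _) , totallyOdd) = totallyOddBasis⇒multiplicative basis totallyOdd
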